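{- Let $n\ge 1$, $k\ge 2$ and $c$ be integers. For a positive integer $m$, let $\mathbb{Z}_m^{**}=\{u\in\{0,1,\dots,m-1\}: \gcd(u,m)=\gcd(1-u,m)=1\}$ be the set of exceptional units of $\mathbb{Z}_m$, and let $$\mathcal{N}_{k,c,2}(n)=\big|\{(x_1,\dots,x_k)\in(\mathbb{Z}_n^{**})^k : x_1^2+\cdots+x_k^2\equiv c \pmod n\}\big|.$$ If $n$ is even, then $\mathcal{N}_{k,c,2}(n)=0$. If $n$ is odd, then \begin{align*} \mathcal{N}_{k,c,2}(n) =&(-1)^{k\omega(n)}\prod_{p\mid n}p^{k\nu_p(n)-\nu_p(n)-k} \Bigg((2-p)^k-\sum_{i=0}^{\lfloor\frac{k}{2}\rfloor} (-1)^{\frac{(p-1)i}{2}}p^{i}\binom{k}{2i}\Big(2^{k-2i} -p\sum_{\substack{j=0\\ p\mid(j-c)}}^{k-2i}\binom{k-2i}{j}\Big)\\ &-\sum_{i=0}^{\lfloor\frac{k-1}{2}\rfloor} (-1)^{\frac{(p-1)(i+1)}{2}}p^{i+1}\binom{k}{2i+1} \sum_{\substack{j=0\\ p\nmid(j-c)}}^{k-2i-1} \binom{k-2i-1}{j}\Big(\frac{j-c}{p}\Big)\Bigg), \end{align*} where the product runs over the distinct primes $p$ dividing $n$.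
   Context: $\omega(n)$ denotes the number of distinct prime divisors of $n$; $\nu_p(n)$ denotes the $p$-adic valuation of $n$ (the exponent of $p$ in $n$); $\big(\frac{x}{p}\big)$ is the Legendre symbol; $\binom{y}{z}=\frac{y!}{z!(y-z)!}$ with $\binom{0}{0}=1$. For $n=1$ the empty product equals $1$. -}

module Defs where

open import Data.Nat as ℕ using (ℕ; zero; suc; _≟_)
open import Data.Nat.Divisibility as ℕD using (_∣?_; divides)
open import Data.Nat.GCD using (gcd)
open import Data.Nat.Primality using (Prime; prime?)
open import Data.Nat.Combinatorics using (_C_)
open import Data.Integer as ℤ using (ℤ; +_; -[1+_]; 0ℤ; 1ℤ; -1ℤ)
import Data.Integer.GCD as ℤG
open import Data.Integer.Divisibility as ℤD using ()
open import Data.Rational as ℚ using (ℚ; _/_; 0ℚ; 1ℚ)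
open import Data.Fin using (Fin; toℕ)
open import Data.Vec using (Vec; []; _∷_)
open import Data.List using (List; []; _∷_; [_]; map; concatMap; filter; length; upTo; foldr)
import Data.List.Relation.Unary.Any as Any
open import Data.Fin using () renaming (zero to fz)
open import Data.Vec.Relation.Unary.All as VAll using (All)
open import Data.List using () renaming (allFin to allFinL)
open import Data.Product using (_×_)
open import Relation.Nullary using (Dec; yes; no; ¬_)
open import Relation.Nullary.Decidable using (_×-dec_; ¬?)
open import Relation.Binary.PropositionalEquality using (_≡_)

IsExceptional : (m : ℕ) → Fin m → Set
IsExceptional m u = (gcd (toℕ u) m ≡ 1) × (ℤG.gcd (1ℤ ℤ.- + toℕ u) (+ m) ≡ 1ℤ)

isExceptional? : (m : ℕ) → (u : Fin m) → Dec (IsExceptional m u)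
isExceptional? m u = (gcd (toℕ u) m ≟ 1) ×-dec (ℤG.gcd (1ℤ ℤ.- + toℕ u) (+ m) ℤ.≟ 1ℤ)

allVecs : (n k : ℕ) → List (Vec (Fin n) k)
allVecs n zero = [ [] ]
allVecs n (suc k) = concatMap (λ x → map (x ∷_) (allVecs n k)) (allFinL n)

sumSq : ∀ {n k} → Vec (Fin n) k → ℤ
sumSq [] = 0ℤ
sumSq (x ∷ xs) = (+ toℕ x) ℤ.* (+ toℕ x) ℤ.+ sumSq xs

Counted : (n : ℕ) (c : ℤ) {k : ℕ} → Vec (Fin n) k → Set
Counted n c v = All (IsExceptional n) v × ((+ n) ℤD.∣ (sumSq v ℤ.- c))

counted? : (n : ℕ) (c : ℤ) {k : ℕ} → (v : Vec (Fin n) k) → Dec (Counted n c v)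
counted? n c v = VAll.all? (isExceptional? n) v ×-dec (n ∣? ℤ.∣ sumSq v ℤ.- c ∣)

N2 : (k : ℕ) (c : ℤ) (n : ℕ) → ℕ
N2 k c n = length (filter (counted? n c) (allVecs n k))

primeDivisors : ℕ → List ℕ
primeDivisors n = filter (λ p → prime? p ×-dec (p ∣? n)) (upTo (suc n))

ω : ℕ → ℕ
ω n = length (primeDivisors n)

ν-fuel : ℕ → ℕ → ℕ → ℕ
ν-fuel zero p m = 0
ν-fuel (suc f) p m with p ∣? m
... | yes (divides q _) = suc (ν-fuel f p q)
... | no _ = 0

-- ν_p(n) (fuel n suffices for n ≥ 1, p ≥ 2)
ν : (p n : ℕ) → ℕ
ν p n = ν-fuel n p n

IsSquareMod : ℤ → ℕ → Set
IsSquareMod a p = Any.Any (λ x → p ℕD.∣ ℤ.∣ (+ x) ℤ.* (+ x) ℤ.- a ∣) (upTo p)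

legendre : ℤ → ℕ → ℤ
legendre a p with p ∣? ℤ.∣ a ∣
... | yes _ = 0ℤ
... | no _ with Any.any? (λ x → p ∣? ℤ.∣ (+ x) ℤ.* (+ x) ℤ.- a ∣) (upTo p)
...   | yes _ = 1ℤ
...   | no _ = -1ℤ

sumTo : ℕ → (ℕ → ℤ) → ℤ
sumTo m f = foldr (λ i s → f i ℤ.+ s) 0ℤ (upTo (suc m))

sumToWhere : ℕ → {P : ℕ → Set} → ((i : ℕ) → Dec (P i)) → (ℕ → ℤ) → ℤ
sumToWhere m P? f = foldr (λ i s → f i ℤ.+ s) 0ℤ (filter P? (upTo (suc m)))

prodℚ : List ℕ → (ℕ → ℚ) → ℚ
prodℚ xs f = foldr (λ p r → f p ℚ.* r) 1ℚ xs

toℚ : ℤ → ℚ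
toℚ z = z / 1

-- 1/m as a rational (m ≥ 1 whenever used)
inv : ℕ → ℚ
inv zero = 0ℚ
inv (suc m) = (+ 1) / suc m

powℤ : ℕ → ℤ → ℚ
powℤ p (+ m) = toℚ (+ (p ℕ.^ m))
powℤ p -[1+ m ] = inv (p ℕ.^ suc m)

sgn : ℕ → ℤ
sgn m = -1ℤ ℤ.^ m

pdiv? : (p : ℕ) (c : ℤ) (j : ℕ) → Dec ((+ p) ℤD.∣ (+ j ℤ.- c))
pdiv? p c j = p ∣? ℤ.∣ + j ℤ.- c ∣

bracket : (k : ℕ) (c : ℤ) (p : ℕ) → ℤ
bracket k c p =
  ((+ 2 ℤ.- + p) ℤ.^ k)
  ℤ.- sumTo (k ℕ./ 2) (λ i →
        sgn (((p ℕ.∸ 1) ℕ.* i) ℕ./ 2) ℤ.* (+ (p ℕ.^ i)) ℤ.* (+ (k C (2 ℕ.* i)))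
        ℤ.* ((+ (2 ℕ.^ (k ℕ.∸ 2 ℕ.* i)))
             ℤ.- (+ p) ℤ.* sumToWhere (k ℕ.∸ 2 ℕ.* i) (pdiv? p c)
                              (λ j → + ((k ℕ.∸ 2 ℕ.* i) C j))))
  ℤ.- sumTo ((k ℕ.∸ 1) ℕ./ 2) (λ i →
        sgn (((p ℕ.∸ 1) ℕ.* (i ℕ.+ 1)) ℕ./ 2) ℤ.* (+ (p ℕ.^ (i ℕ.+ 1)))
        ℤ.* (+ (k C (2 ℕ.* i ℕ.+ 1)))
        ℤ.* sumToWhere (k ℕ.∸ 2 ℕ.* i ℕ.∸ 1) (λ j → ¬? (pdiv? p c j))
              (λ j → (+ ((k ℕ.∸ 2 ℕ.* i ℕ.∸ 1) C j)) ℤ.* legendre (+ j ℤ.- c) p))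

rhs : (k : ℕ) (c : ℤ) (n : ℕ) → ℚ
rhs k c n =
  toℚ (sgn (k ℕ.* ω n)) ℚ.*
  prodℚ (primeDivisors n) (λ p →
    powℤ p (+ (k ℕ.* ν p n) ℤ.- + ν p n ℤ.- + k) ℚ.* toℚ (bracket k c p))

{-# OPTIONS --safe #-}
-- Write W n k a for the number of k-tuples of exceptional units of ℤ/n whose squares sum to a.
-- By the Chinese remainder theorem W is multiplicative in n, and because an exceptional unit y
-- is prime to p, z ↦ (y + n z)² is affine of invertible slope in z modulo p n when p ∣ n, so
-- W (p n) k = p^(k-1) W n k. This reduces the count to W p k for an odd prime p.
-- There W p k = T^k δ, where T = A - B, A f(a) = ∑ₓ f(a - x²) and B f(a) = f(a) + f(a - 1) commute.
-- The constant functions are eigenvectors of T for p - 2, and A maps η = pδ - 1 to pχ and χ to εη,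
-- where χ is the Legendre symbol and ε = χ(-1) = (-1)^((p-1)/2). Hence A² = εp on the span of η and χ,
-- and the binomial expansion of T^k applied to pδ = 1 + η is (-1)^k times the bracket of the formula.
module Submission where

open import Defs
open import Data.Nat using (ℕ; _≤_; _%_)
open import Data.Integer using (ℤ; +_)
open import Data.Rational using (ℚ)
open import Data.Product using (_×_)
open import Relation.Binary.PropositionalEquality using (_≡_)

open import Data.Nat as ℕ using (zero; suc; _<_; _∸_; _/_; NonZero; z≤n; s≤s)
import Data.Nat.Properties as ℕ
open import Data.Integer using (0ℤ; 1ℤ; -1ℤ; _+_; _*_; _-_; -_; ∣_∣)
import Data.Integer as ℤ
import Data.Integer.Properties as ℤ
open import Data.Integer.DivMod using (_%ℕ_; _/ℕ_; a≡a%ℕn+[a/ℕn]*n; n%ℕd<d)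
open import Data.Integer.Divisibility.Signed
open import Data.Integer.Tactic.RingSolver using (solve-∀)
import Data.Nat.Divisibility as ℕ
open import Data.Fin as Fin using (Fin; toℕ)
import Data.Fin.Properties as Fin
open import Data.Product using (_,_; proj₁; proj₂; ∃-syntax)
open import Data.Sum using (_⊎_; inj₁; inj₂)
open import Function using (_∘_; id)
open import Relation.Nullary using (Dec; yes; no; ¬_; contradiction)
open import Relation.Binary.PropositionalEquality
  using (_≢_; refl; sym; trans; cong; cong₂; subst; module ≡-Reasoning)
open import Data.Nat.Combinatorics
  using (_C_; nCn≡1; nCk≡nC[n∸k]; k>n⇒nCk≡0; nCk+nC[k+1]≡[n+1]C[k+1])
open import Data.Nat.DivMod using (m≡m%n+[m/n]*n; m%n<n; m*n/n≡m; +-distrib-/-∣ʳ)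
open import Algebra.Bundles using (AbelianGroup; CommutativeMonoid)
import Algebra.Properties.CommutativeMonoid.Sum ℤ.+-0-commutativeMonoid as CM
import Algebra.Properties.Semiring.Sum ℤ.+-*-semiring as SR

import Data.Sum
import Data.List.Relation.Unary.Any as Any
open import Data.List
  using (List; []; _∷_; _++_; map; concatMap; filter; length; foldr; tabulate; allFin; upTo; applyUpTo)
open import Data.Vec using (Vec; []; _∷_)
open import Data.Vec.Relation.Unary.All using ([]; _∷_)
open import Relation.Nullary.Decidable using (_×-dec_; ¬?)
open import Data.List.Membership.Propositional using (lose)
open import Data.List.Membership.Propositional.Properties using (∈-upTo⁺)
open import Data.Nat.Coprimality as Coprime using (Coprime; coprime?; coprime-Bézout; coprime-divisor)
open import Data.Nat.GCD using (module Bézout)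
open import Data.Nat.Primality
  using (Prime; prime?; prime⇒nonZero; prime⇒nonTrivial; prime⇒irreducible; euclidsLemma; ¬prime[1]; productOfPrimes≢0)
open import Data.Nat.Primality.Factorisation using (PrimeFactorisation; factorise)
open import Data.Nat.ListAction using (product)
open import Data.Nat.ListAction.Properties using (∈⇒∣product)
import Data.List.Relation.Unary.All as All
open import Data.List.Relation.Unary.All.Properties using (all-filter)
import Data.Rational as ℚ
import Data.Rational.Properties as ℚ
import Data.Rational.Unnormalised as ℚᵘ
import Data.Rational.Unnormalised.Properties as ℚᵘ

open import Algebra.Properties.Group (AbelianGroup.group ℤ.+-0-abelianGroup)
  using () renaming (∙-cancelˡ to +-cancelˡ)
open import Algebra.Properties.CommutativeSemigroup (CommutativeMonoid.commutativeSemigroup ℚ.*-1-commutativeMonoid)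
  using () renaming (interchange to ℚ-interchange)

-- The summation indices of the formula are those of two nested binomial expansions. T^k is expanded
-- in powers A^m B^(k - m), and m = 2i or m = 2i + 1 gives the two sums over i; B^(k - m) is
-- expanded in translations a ↦ a - j, which gives the sums over j. Even powers of A return
-- multiples of η, hence the conditions p ∣ j - c; odd powers return multiples of χ, hence the
-- Legendre symbols.
--
-- The factor p in pδ = 1 + η keeps this decomposition integral. It is also the p that absorbs a
-- denominator: the exponent kν - ν - k equals (k - 1)(ν - 1) - 1, and its - 1 cancels against that
-- p. The counting therefore stays in ℤ, and ℚ appears only when the formula itself is assembled.
--
-- A function on ℤ / n is modelled as a periodic function on ℤ, and a change of variable is obtained
-- by inserting `δ` and exchanging sums. The theory of χ rests on one count: x² ≡ a has 1 + χ(a)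
-- roots. Periodicity, the vanishing of ∑ χ and the conic sum follow by double counting, and these
-- sums lead in turn to χ(- b) = χ(- 1) χ(b) and to the value of χ(- 1).

open ≡-Reasoning

-- Finite sums of integers

∑< : ℕ → (ℕ → ℤ) → ℤ
∑< n f = CM.sum {n} (f ∘ toℕ)

infixl 5 ∑<
syntax ∑< n (λ i → e) = ∑[ i < n ] e

∑-cong : ∀ n {f g} → (∀ i → i < n → f i ≡ g i) → ∑< n f ≡ ∑< n g
∑-cong n f≗g = CM.sum-cong-≗ (λ i → f≗g (toℕ i) (Fin.toℕ<n i))

∑-ext : ∀ n {f g} → (∀ i → f i ≡ g i) → ∑< n f ≡ ∑< n g
∑-ext n f≗g = ∑-cong n (λ i _ → f≗g i)

∑-+ : ∀ n f g → (∑[ i < n ] (f i + g i)) ≡ ∑< n f + ∑< n g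
∑-+ n f g = CM.∑-distrib-+ {n} (f ∘ toℕ) (g ∘ toℕ)

∑-*ˡ : ∀ n c f → (∑[ i < n ] (c * f i)) ≡ c * ∑< n f
∑-*ˡ n c f = sym (SR.*-distribˡ-sum {n} c (f ∘ toℕ))

∑-*ʳ : ∀ n c f → (∑[ i < n ] (f i * c)) ≡ ∑< n f * c
∑-*ʳ n c f = sym (SR.*-distribʳ-sum {n} c (f ∘ toℕ))

∑-neg : ∀ n f → (∑[ i < n ] (- f i)) ≡ - ∑< n f
∑-neg zero    f = refl
∑-neg (suc n) f = trans (cong (_+_ (- f 0)) (∑-neg n (f ∘ suc)))
                        (sym (ℤ.neg-distrib-+ (f 0) (∑< n (f ∘ suc))))

∑-- : ∀ n f g → (∑[ i < n ] (f i - g i)) ≡ ∑< n f - ∑< n g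
∑-- n f g = trans (∑-+ n f (-_ ∘ g)) (cong (_+_ (∑< n f)) (∑-neg n g))

∑-swap : ∀ m n (f : ℕ → ℕ → ℤ) →
         (∑[ i < m ] ∑[ j < n ] f i j) ≡ (∑[ j < n ] ∑[ i < m ] f i j)
∑-swap m n f = CM.∑-comm {m} {n} (λ i j → f (toℕ i) (toℕ j))

∑-const : ∀ n c → (∑[ i < n ] c) ≡ + n * c
∑-const zero    c = refl
∑-const (suc n) c = trans (cong (λ s → c + s) (∑-const n c)) (lemma c (+ n))
  where
  lemma : ∀ c n → c + n * c ≡ (1ℤ + n) * c
  lemma = solve-∀

∑-zero : ∀ n → (∑[ i < n ] 0ℤ) ≡ 0ℤ
∑-zero n = trans (∑-const n 0ℤ) (ℤ.*-zeroʳ (+ n))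

∑-last : ∀ n f → ∑< (suc n) f ≡ ∑< n f + f n
∑-last zero    f = ℤ.+-comm (f 0) 0ℤ
∑-last (suc n) f = trans (cong (_+_ (f 0)) (∑-last n (f ∘ suc)))
                         (sym (ℤ.+-assoc (f 0) (∑< n (f ∘ suc)) (f (suc n))))

∑-single : ∀ n f r → r < n → (∀ i → i < n → i ≢ r → f i ≡ 0ℤ) → ∑< n f ≡ f r
∑-single (suc n) f zero r<n f≡0 = begin
  f 0 + ∑< n (f ∘ suc)    ≡⟨ cong (_+_ (f 0)) (∑-cong n λ i i<n → f≡0 (suc i) (s≤s i<n) λ ()) ⟩
  f 0 + ∑< n (λ _ → 0ℤ)   ≡⟨ cong (_+_ (f 0)) (∑-zero n) ⟩
  f 0 + 0ℤ                ≡⟨ ℤ.+-identityʳ (f 0) ⟩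
  f 0                     ∎
∑-single (suc n) f (suc r) (s≤s r<n) f≡0 = begin
  f 0 + ∑< n (f ∘ suc)    ≡⟨ cong₂ _+_ (f≡0 0 (s≤s z≤n) λ ())
                               (∑-single n (f ∘ suc) r r<n λ i i<n i≢r →
                                 f≡0 (suc i) (s≤s i<n) (i≢r ∘ ℕ.suc-injective)) ⟩
  0ℤ + f (suc r)          ≡⟨ ℤ.+-identityˡ (f (suc r)) ⟩
  f (suc r)               ∎

∑-++ : ∀ m n f → ∑< (m ℕ.+ n) f ≡ ∑< m f + (∑[ i < n ] f (m ℕ.+ i))
∑-++ zero    n f = sym (ℤ.+-identityˡ _)
∑-++ (suc m) n f = trans (cong (_+_ (f 0)) (∑-++ m n (f ∘ suc)))
                         (sym (ℤ.+-assoc (f 0) (∑< m (f ∘ suc)) _))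

-- Division with remainder as a change of index. The same splitting serves the Chinese remainder
-- theorem, the lifting from n to p n and, with m = 2, the separation of even from odd indices.
∑-blocks : ∀ n m f → ∑< (n ℕ.* m) f ≡ (∑[ z < n ] ∑[ y < m ] f (y ℕ.+ z ℕ.* m))
∑-blocks zero    m f = refl
∑-blocks (suc n) m f = begin
  ∑< (m ℕ.+ n ℕ.* m) f
    ≡⟨ ∑-++ m (n ℕ.* m) f ⟩
  ∑< m f + ∑< (n ℕ.* m) (λ i → f (m ℕ.+ i))
    ≡⟨ cong₂ _+_ (∑-ext m λ y → cong f (sym (ℕ.+-identityʳ y)))
                 (trans (∑-blocks n m (λ i → f (m ℕ.+ i)))
                        (∑-ext n λ z → ∑-ext m λ y → cong f (shuffle z y))) ⟩
  (∑[ y < m ] f (y ℕ.+ 0)) + (∑[ z < n ] ∑[ y < m ] f (y ℕ.+ suc z ℕ.* m))  ∎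
  where
  shuffle : ∀ z y → m ℕ.+ (y ℕ.+ z ℕ.* m) ≡ y ℕ.+ (m ℕ.+ z ℕ.* m)
  shuffle z y = trans (sym (ℕ.+-assoc m y _))
                      (trans (cong (ℕ._+ z ℕ.* m) (ℕ.+-comm m y)) (ℕ.+-assoc y m _))

-- Indicator functions and divisibility

private variable
  P Q : Set

⟦_⟧ : Dec P → ℤ
⟦ yes _ ⟧ = 1ℤ
⟦ no  _ ⟧ = 0ℤ

⟦⟧-cong : (p? : Dec P) (q? : Dec Q) → (P → Q) → (Q → P) → ⟦ p? ⟧ ≡ ⟦ q? ⟧
⟦⟧-cong (yes p) (yes q) f g = refl
⟦⟧-cong (yes p) (no ¬q) f g = contradiction (f p) ¬q
⟦⟧-cong (no ¬p) (yes q) f g = contradiction (g q) ¬p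
⟦⟧-cong (no ¬p) (no ¬q) f g = refl

⟦⟧-yes : (p? : Dec P) → P → ⟦ p? ⟧ ≡ 1ℤ
⟦⟧-yes (yes _) p = refl
⟦⟧-yes (no ¬p) p = contradiction p ¬p

⟦⟧-no : (p? : Dec P) → ¬ P → ⟦ p? ⟧ ≡ 0ℤ
⟦⟧-no (yes p) ¬p = contradiction p ¬p
⟦⟧-no (no _)  ¬p = refl

δ : ℕ → ℤ → ℤ
δ n a = ⟦ + n ∣? a ⟧

-- Functions on ℤ / n, and sums over a complete residue system

Periodic : ℕ → (ℤ → ℤ) → Set
Periodic n f = ∀ a b → + n ∣ a - b → f a ≡ f b

∣-resp : ∀ {i a b} → a ≡ b → i ∣ a → i ∣ b
∣-resp {i} = subst (i ∣_)

∣-transport : ∀ {i} a b → i ∣ a - b → i ∣ b → i ∣ a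
∣-transport a b d e = ∣-resp (lemma a b) (∣m∣n⇒∣m+n d e)
  where
  lemma : ∀ a b → a - b + b ≡ a
  lemma = solve-∀

∣-flip : ∀ {i} a b → i ∣ a - b → i ∣ b - a
∣-flip a b d = ∣-resp (lemma a b) (∣m⇒∣-m d)
  where
  lemma : ∀ a b → - (a - b) ≡ b - a
  lemma = solve-∀

δ-periodic : ∀ n → Periodic n (δ n)
δ-periodic n a b d = ⟦⟧-cong _ _ (∣-transport b a (∣-flip a b d)) (∣-transport a b d)

δ-flip : ∀ n a b → δ n (a - b) ≡ δ n (b - a)
δ-flip n a b = ⟦⟧-cong _ _ (∣-flip a b) (∣-flip b a)

δ-sift : ∀ {n f} → Periodic n f → ∀ a b → δ n (a - b) * f a ≡ δ n (a - b) * f b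
δ-sift {n} per a b with + n ∣? (a - b)
... | yes d = cong (1ℤ *_) (per a b d)
... | no  _ = refl

small-residues-unique : ∀ {n i r} → i < n → r < n → + n ∣ + i - + r → i ≡ r
small-residues-unique {n} {i} {r} i<n r<n d =
  ℤ.+-injective (ℤ.i-j≡0⇒i≡j (+ i) (+ r) (ℤ.∣i∣≡0⇒i≡0 ∣i-r∣≡0))
  where
  ∣i-r∣<n : ∣ + i - + r ∣ < n
  ∣i-r∣<n = subst (_< n) (cong ∣_∣ (sym (ℤ.m-n≡m⊖n i r)))
              (ℕ.≤-<-trans (ℤ.∣m⊝n∣≤m⊔n i r) (ℕ.⊔-lub i<n r<n))

  ∣i-r∣≡0 : ∣ + i - + r ∣ ≡ 0
  ∣i-r∣≡0 with ∣ + i - + r ∣ | ∣i-r∣<n | ∣⇒∣ᵤ d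
  ... | zero  | _  | _ = refl
  ... | suc k | lt | e = contradiction e (ℕ.>⇒∤ lt)

residue : ∀ n .{{_ : NonZero n}} a → ∃[ r ] (r < n × + n ∣ a - + r)
residue n a = a %ℕ n , n%ℕd<d a n ,
  divides (a /ℕ n) (trans (cong (_- + (a %ℕ n)) (a≡a%ℕn+[a/ℕn]*n a n)) (cancel (+ (a %ℕ n)) ((a /ℕ n) * + n)))
  where
  cancel : ∀ r x → r + x - r ≡ x
  cancel = solve-∀

∑δ≡1 : ∀ n .{{_ : NonZero n}} a → (∑[ i < n ] δ n (+ i - a)) ≡ 1ℤ
∑δ≡1 n a with residue n a
... | r , r<n , n∣a-r = trans
  (∑-single n (λ i → δ n (+ i - a)) r r<n λ i i<n i≢r → ⟦⟧-no (+ n ∣? + i - a) λ d →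
    i≢r (small-residues-unique i<n r<n
      (∣-resp (lemma (+ i) a (+ r)) (∣m∣n⇒∣m-n d (∣-flip a (+ r) n∣a-r)))))
  (⟦⟧-yes (+ n ∣? + r - a) (∣-flip a (+ r) n∣a-r))
  where
  lemma : ∀ i a r → i - a - (r - a) ≡ i - r
  lemma = solve-∀

∑-sift : ∀ n .{{_ : NonZero n}} {f} → Periodic n f → ∀ a →
         (∑[ w < n ] (δ n (+ w - a) * f (+ w))) ≡ f a
∑-sift n {f} per a = begin
  (∑[ w < n ] (δ n (+ w - a) * f (+ w)))  ≡⟨ ∑-ext n (λ w → δ-sift per (+ w) a) ⟩
  (∑[ w < n ] (δ n (+ w - a) * f a))      ≡⟨ ∑-*ʳ n (f a) (λ w → δ n (+ w - a)) ⟩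
  (∑[ w < n ] δ n (+ w - a)) * f a        ≡⟨ cong (_* f a) (∑δ≡1 n a) ⟩
  1ℤ * f a                                ≡⟨ ℤ.*-identityˡ (f a) ⟩
  f a                                     ∎

-- The only root is z ≡ - u b, because `u` inverts the slope `m`.
∑δ-affine : ∀ n .{{_ : NonZero n}} u m b → + n ∣ u * m - 1ℤ →
            (∑[ z < n ] δ n (b + m * + z)) ≡ 1ℤ
∑δ-affine n u m b um≡1 = trans
  (∑-ext n λ z → ⟦⟧-cong (+ n ∣? b + m * + z) (+ n ∣? + z - - (u * b))
    (λ d → ∣-resp (to u m b (+ z)) (∣m∣n⇒∣m-n (∣n⇒∣m*n u d) (∣n⇒∣m*n (+ z) um≡1)))
    (λ d → ∣-resp (from u m b (+ z)) (∣m∣n⇒∣m-n (∣n⇒∣m*n m d) (∣n⇒∣m*n b um≡1))))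
  (∑δ≡1 n (- (u * b)))
  where
  to : ∀ u m b z → u * (b + m * z) - z * (u * m - 1ℤ) ≡ z - - (u * b)
  to = solve-∀
  from : ∀ u m b z → m * (z - - (u * b)) - b * (u * m - 1ℤ) ≡ b + m * z
  from = solve-∀

-- No permutation of the residues is constructed: each value of f is sifted out by `δ`, the sums are
-- exchanged, and `∑δ-affine` says that every residue w is hit exactly once.
∑-reindex : ∀ n .{{_ : NonZero n}} {f} → Periodic n f → ∀ u m b → + n ∣ u * m - 1ℤ →
            (∑[ z < n ] f (b + m * + z)) ≡ (∑[ w < n ] f (+ w))
∑-reindex n {f} per u m b um≡1 = begin
  (∑[ z < n ] f (b + m * + z))
    ≡⟨ ∑-ext n (λ z → sym (∑-sift n per (b + m * + z))) ⟩
  (∑[ z < n ] ∑[ w < n ] (δ n (+ w - (b + m * + z)) * f (+ w)))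
    ≡⟨ ∑-swap n n (λ z w → δ n (+ w - (b + m * + z)) * f (+ w)) ⟩
  (∑[ w < n ] ∑[ z < n ] (δ n (+ w - (b + m * + z)) * f (+ w)))
    ≡⟨ ∑-ext n (λ w → trans (∑-*ʳ n (f (+ w)) (λ z → δ n (+ w - (b + m * + z)))) (one w)) ⟩
  (∑[ w < n ] f (+ w))  ∎
  where
  shape : ∀ w b m z → w - (b + m * z) ≡ (w - b) + (- m) * z
  shape = solve-∀
  signs : ∀ u m → u * m - 1ℤ ≡ (- u) * (- m) - 1ℤ
  signs = solve-∀
  one : ∀ w → (∑[ z < n ] δ n (+ w - (b + m * + z))) * f (+ w) ≡ f (+ w)
  one w = trans (cong (_* f (+ w)) (trans
            (∑-ext n λ z → cong (δ n) (shape (+ w) b m (+ z)))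
            (∑δ-affine n (- u) (- m) (+ w - b) (∣-resp (signs u m) um≡1))))
          (ℤ.*-identityˡ (f (+ w)))

coprime⇒inverse : ∀ {n} a → Coprime n ∣ a ∣ → ∃[ u ] (+ n ∣ u * a - 1ℤ)
coprime⇒inverse {n} a c with ℤ.+∣i∣≡i⊎+∣i∣≡-i a | ∣a∣-inverse
  where
  ∣a∣-inverse : ∃[ u ] (+ n ∣ u * + ∣ a ∣ - 1ℤ)
  ∣a∣-inverse with coprime-Bézout c
  ... | Bézout.+- x y eq = - + y , divides (- + x) (begin
    - + y * + ∣ a ∣ - 1ℤ        ≡⟨ shape (+ y) (+ ∣ a ∣) ⟩
    - (1ℤ + + y * + ∣ a ∣)      ≡⟨ cong (λ s → - (1ℤ + s)) (ℤ.pos-* y ∣ a ∣) ⟨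
    - + (1 ℕ.+ y ℕ.* ∣ a ∣)     ≡⟨ cong (λ s → - + s) eq ⟩
    - + (x ℕ.* n)               ≡⟨ cong -_ (ℤ.pos-* x n) ⟩
    - (+ x * + n)               ≡⟨ ℤ.neg-distribˡ-* (+ x) (+ n) ⟩
    - + x * + n                 ∎)
    where
    shape : ∀ y a → - y * a - 1ℤ ≡ - (1ℤ + y * a)
    shape = solve-∀
  ... | Bézout.-+ x y eq = + y , divides (+ x) (begin
    + y * + ∣ a ∣ - 1ℤ          ≡⟨ cong (_- 1ℤ) (ℤ.pos-* y ∣ a ∣) ⟨
    + (y ℕ.* ∣ a ∣) - 1ℤ        ≡⟨ cong (λ s → + s - 1ℤ) eq ⟨
    1ℤ + + (x ℕ.* n) - 1ℤ       ≡⟨ shape (+ (x ℕ.* n)) ⟩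
    + (x ℕ.* n)                 ≡⟨ ℤ.pos-* x n ⟩
    + x * + n                   ∎)
    where
    shape : ∀ y → 1ℤ + y - 1ℤ ≡ y
    shape = solve-∀
... | inj₁ ∣a∣≡a  | u , d = u , subst (λ s → + n ∣ u * s - 1ℤ) ∣a∣≡a d
... | inj₂ ∣a∣≡-a | u , d = - u , ∣-resp (trans (cong (λ s → u * s - 1ℤ) ∣a∣≡-a) (signs u a)) d
  where
  signs : ∀ u a → u * (- a) - 1ℤ ≡ (- u) * a - 1ℤ
  signs = solve-∀

n∣1-1 : ∀ n → + n ∣ 1ℤ * 1ℤ - 1ℤ
n∣1-1 n = ∣ᵤ⇒∣ (n ℕ.∣0)

-- The Legendre symbol

-- `legendre` is a nested decision; the index ties each of its values to the evidence behind it. The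
-- evidence in `nonsquare` covers only x < p, the range that `legendre` searches.
data LegendreView (p : ℕ) (a : ℤ) : ℤ → Set where
  divisible : + p ∣ a → LegendreView p a 0ℤ
  square    : ¬ + p ∣ a → ∀ x → + p ∣ + x * + x - a → LegendreView p a 1ℤ
  nonsquare : ¬ + p ∣ a → (∀ x → x < p → ¬ + p ∣ + x * + x - a) → LegendreView p a -1ℤ

legendreView : ∀ p a → LegendreView p a (legendre a p)
legendreView p a with p ℕ.∣? ∣ a ∣
... | yes d = divisible (∣ᵤ⇒∣ d)
... | no ¬d with Any.any? (λ x → p ℕ.∣? ∣ + x * + x - a ∣) (upTo p)
...   | yes s = let x , e = Any.satisfied s in square (¬d ∘ ∣⇒∣ᵤ) x (∣ᵤ⇒∣ e)
...   | no ¬s = nonsquare (¬d ∘ ∣⇒∣ᵤ) λ x x<p e →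
                  ¬s (lose (∈-upTo⁺ x<p) (∣⇒∣ᵤ e))

square-periodic : ∀ {n} x y → + n ∣ x - y → + n ∣ x * x - y * y
square-periodic x y d = ∣-resp (lemma x y) (∣m⇒∣m*n (x + y) d)
  where
  lemma : ∀ x y → (x - y) * (x + y) ≡ x * x - y * y
  lemma = solve-∀

∑-nonpos : ∀ n f → (∀ i → i < n → f i ℤ.≤ 0ℤ) → ∑< n f ℤ.≤ 0ℤ
∑-nonpos zero    f f≤0 = ℤ.≤-refl
∑-nonpos (suc n) f f≤0 =
  ℤ.+-mono-≤ (f≤0 0 (s≤s z≤n)) (∑-nonpos n (f ∘ suc) λ i i<n → f≤0 (suc i) (s≤s i<n))

-- Turns an inequality for every residue into an equality for every residue once the total is known;
-- this is how χ(b) + χ(- b) = 0 is obtained when - 1 is a nonsquare.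
∑-nonpos-zero : ∀ n f → (∀ i → i < n → f i ℤ.≤ 0ℤ) → ∑< n f ≡ 0ℤ → ∀ i → i < n → f i ≡ 0ℤ
∑-nonpos-zero (suc n) f f≤0 ∑≡0 = go
  where
  s = ∑< n (f ∘ suc)
  s≤0 : s ℤ.≤ 0ℤ
  s≤0 = ∑-nonpos n (f ∘ suc) λ i i<n → f≤0 (suc i) (s≤s i<n)
  f0≡0 : f 0 ≡ 0ℤ
  f0≡0 = ℤ.≤-antisym (f≤0 0 (s≤s z≤n))
    (subst (ℤ._≤ f 0) ∑≡0 (subst (f 0 + s ℤ.≤_) (ℤ.+-identityʳ (f 0)) (ℤ.+-monoʳ-≤ (f 0) s≤0)))
  s≡0 : s ≡ 0ℤ
  s≡0 = trans (sym (ℤ.+-identityˡ s)) (trans (cong (_+ s) (sym f0≡0)) ∑≡0)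
  go : ∀ i → i < suc n → f i ≡ 0ℤ
  go zero    _         = f0≡0
  go (suc i) (s≤s i<n) = ∑-nonpos-zero n (f ∘ suc) (λ j j<n → f≤0 (suc j) (s≤s j<n)) s≡0 i i<n

-- The induction strips off the outermost pair, indices 0 and 2m + 1, of a sequence with reflection
-- symmetry. It serves to pair x with p - x.
∑-fold : ∀ m f → (∀ i j → suc (i ℕ.+ j) ≡ m ℕ.+ m → f i ≡ f j) →
         ∑< (m ℕ.+ m) f ≡ ∑< m f + ∑< m f
∑-fold zero    f symm = refl
∑-fold (suc m) f symm = begin
  f 0 + ∑< (m ℕ.+ suc m) f′
    ≡⟨ cong (λ k → f 0 + ∑< k f′) (ℕ.+-suc m m) ⟩
  f 0 + ∑< (suc (m ℕ.+ m)) f′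
    ≡⟨ cong (_+_ (f 0)) (∑-last (m ℕ.+ m) f′) ⟩
  f 0 + (∑< (m ℕ.+ m) f′ + f (suc (m ℕ.+ m)))
    ≡⟨ cong₂ (λ s t → f 0 + (s + t))
         (∑-fold m f′ λ i j e → symm (suc i) (suc j)
           (cong suc (trans (cong suc (ℕ.+-suc i j)) (trans (cong suc e) (sym (ℕ.+-suc m m))))))
         (sym (symm 0 (suc (m ℕ.+ m)) (cong suc (sym (ℕ.+-suc m m))))) ⟩
  f 0 + (∑< m f′ + ∑< m f′ + f 0)
    ≡⟨ shape (f 0) (∑< m f′) ⟩
  f 0 + ∑< m f′ + (f 0 + ∑< m f′)  ∎
  where
  f′ = f ∘ suc
  shape : ∀ a s → a + (s + s + a) ≡ a + s + (a + s)
  shape = solve-∀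

-- Fixes the sum modulo 2, hence its double modulo 4, which is the precision that decides the parity
-- of (p - 1) / 2.
∑-odd : ∀ n f → (∀ i → i < n → ∃[ t ] (f i ≡ 1ℤ + + 2 * t)) → ∃[ t ] (∑< n f ≡ + n + + 2 * t)
∑-odd zero    f odd = 0ℤ , refl
∑-odd (suc n) f odd with odd 0 (s≤s z≤n) | ∑-odd n (f ∘ suc) (λ i i<n → odd (suc i) (s≤s i<n))
... | t , e | s , e′ = t + s , trans (cong₂ _+_ e e′) (shape t s (+ n))
  where
  shape : ∀ t s n → 1ℤ + + 2 * t + (n + + 2 * s) ≡ 1ℤ + n + + 2 * (t + s)
  shape = solve-∀

sgn-even : ∀ m t → + m ≡ + 2 * t → sgn m ≡ 1ℤ
sgn-even m t e = begin
  -1ℤ ℤ.^ m              ≡⟨ cong (-1ℤ ℤ.^_) (trans (cong ∣_∣ e) (ℤ.abs-* (+ 2) t)) ⟩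
  -1ℤ ℤ.^ (2 ℕ.* ∣ t ∣)  ≡⟨ ℤ.^-*-assoc -1ℤ 2 ∣ t ∣ ⟨
  1ℤ ℤ.^ ∣ t ∣           ≡⟨ ℤ.^-zeroˡ ∣ t ∣ ⟩
  1ℤ                     ∎

square-root-∣ : ∀ {n} r a → + n ∣ r * r - a → + n ∣ r → + n ∣ a
square-root-∣ r a n∣r²-a n∣r = ∣-resp (shape r a) (∣m∣n⇒∣m-n (∣m⇒∣m*n r n∣r) n∣r²-a)
  where
  shape : ∀ r a → r * r - (r * r - a) ≡ a
  shape = solve-∀

-- Roots found algebraically may be any integers, while `nonsquare` speaks only of roots below p.
residue-root : ∀ n .{{_ : NonZero n}} z a → + n ∣ z * z - a → ∃[ r ] (r < n × + n ∣ + r * + r - a)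
residue-root n z a root with residue n z
... | r , r<n , d = r , r<n ,
  ∣-resp (shape (+ r) z a) (∣m∣n⇒∣m+n (square-periodic (+ r) z (∣-flip z (+ r) d)) root)
  where
  shape : ∀ r z a → r * r - z * z + (z * z - a) ≡ r * r - a
  shape = solve-∀

-- Legendre symbol sums modulo an odd prime

module OddPrime (p : ℕ) (p-prime : Prime p) (h : ℕ) (p≡1+2h : p ≡ suc (h ℕ.+ h)) where

  instance
    p≢0 : NonZero p
    p≢0 = prime⇒nonZero p-prime

  euclid : ∀ a b → + p ∣ a * b → (+ p ∣ a) ⊎ (+ p ∣ b)
  euclid a b d = Data.Sum.map ∣ᵤ⇒∣ ∣ᵤ⇒∣
    (euclidsLemma ∣ a ∣ ∣ b ∣ p-prime (subst (p ℕ.∣_) (ℤ.abs-* a b) (∣⇒∣ᵤ d)))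

  p∤1 : ¬ + p ∣ 1ℤ
  p∤1 d = ¬prime[1] (subst Prime (ℕ.∣1⇒≡1 (∣⇒∣ᵤ d)) p-prime)

  p∤2 : ¬ + p ∣ + 2
  p∤2 d = p∤1 (∣-resp (trans (cong (λ s → + s - + h * + 2) p≡1+2h) (shape (+ h)))
                 (∣m∣n⇒∣m-n (∣-refl {+ p}) (∣n⇒∣m*n (+ h) d)))
    where
    shape : ∀ h → 1ℤ + (h + h) - h * + 2 ≡ 1ℤ
    shape = solve-∀

  p∤small : ∀ i → suc i < p → ¬ + p ∣ + suc i
  p∤small i i<p d = ℕ.>⇒∤ i<p (∣⇒∣ᵤ d)

  inverse : ∀ a → ¬ + p ∣ a → ∃[ u ] (+ p ∣ u * a - 1ℤ)
  inverse a p∤a = coprime⇒inverse a λ { {d} (d∣p , d∣a) → case d d∣p d∣a (prime⇒irreducible p-prime d∣p) }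
    where
    case : ∀ d → d ℕ.∣ p → d ℕ.∣ ∣ a ∣ → d ≡ 1 ⊎ d ≡ p → d ≡ 1
    case d _ _   (inj₁ d≡1)  = d≡1
    case d _ d∣a (inj₂ refl) = contradiction (∣ᵤ⇒∣ d∣a) p∤a

  ∑δ-at-0 : (∑[ x < p ] δ p (+ x)) ≡ 1ℤ
  ∑δ-at-0 = trans (∑-ext p λ x → cong (δ p) (sym (ℤ.+-identityʳ (+ x)))) (∑δ≡1 p 0ℤ)

  χ : ℤ → ℤ
  χ a = legendre a p

  view : ∀ a → LegendreView p a (χ a)
  view = legendreView p

  -- A nonzero a with a square root x has exactly the two roots x ≢ - x.
  sqrt-count : ∀ a → (∑[ x < p ] δ p (+ x * + x - a)) ≡ 1ℤ + χ a
  sqrt-count a with χ a | view a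
  ... | _ | divisible p∣a = trans
        (∑-ext p λ x → ⟦⟧-cong (+ p ∣? + x * + x - a) (+ p ∣? + x)
          (λ d → Data.Sum.reduce (euclid (+ x) (+ x) (∣-transport (+ x * + x) a d p∣a)))
          (λ d → ∣m∣n⇒∣m-n (∣m⇒∣m*n (+ x) d) p∣a))
        ∑δ-at-0
  ... | _ | nonsquare _ no-root = trans
        (∑-cong p λ x x<p → ⟦⟧-no (+ p ∣? + x * + x - a) (no-root x x<p))
        (∑-zero p)
  ... | _ | square p∤a r p∣r²-a = begin
    (∑[ x < p ] δ p (+ x * + x - a))
      ≡⟨ ∑-ext p (λ x → two-roots (+ x)) ⟩
    (∑[ x < p ] (δ p (+ x - + r) + δ p (+ x - - + r)))
      ≡⟨ ∑-+ p (λ x → δ p (+ x - + r)) (λ x → δ p (+ x - - + r)) ⟩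
    (∑[ x < p ] δ p (+ x - + r)) + (∑[ x < p ] δ p (+ x - - + r))
      ≡⟨ cong₂ _+_ (∑δ≡1 p (+ r)) (∑δ≡1 p (- + r)) ⟩
    1ℤ + 1ℤ  ∎
    where
    p∤r : ¬ + p ∣ + r
    p∤r d = p∤a (square-root-∣ (+ r) a p∣r²-a d)
    factor : ∀ x r a → (x - r) * (x - - r) + (r * r - a) ≡ x * x - a
    factor = solve-∀
    two-r : ∀ x r → x - - r - (x - r) ≡ + 2 * r
    two-r = solve-∀
    two-roots : ∀ x → δ p (x * x - a) ≡ δ p (x - + r) + δ p (x - - + r)
    two-roots x with + p ∣? x - + r | + p ∣? x - - + r
    ... | yes d | yes e = contradiction (euclid (+ 2) (+ r) (∣-resp (two-r x (+ r)) (∣m∣n⇒∣m-n e d)))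
                            λ { (inj₁ p∣2) → p∤2 p∣2 ; (inj₂ p∣r) → p∤r p∣r }
    ... | yes d | no _  = ⟦⟧-yes (+ p ∣? x * x - a)
                            (∣-resp (factor x (+ r) a) (∣m∣n⇒∣m+n (∣m⇒∣m*n (x - - + r) d) p∣r²-a))
    ... | no _  | yes e = ⟦⟧-yes (+ p ∣? x * x - a)
                            (∣-resp (factor x (+ r) a) (∣m∣n⇒∣m+n (∣n⇒∣m*n (x - + r) e) p∣r²-a))
    ... | no ¬d | no ¬e = ⟦⟧-no (+ p ∣? x * x - a) λ f →
      contradiction (euclid (x - + r) (x - - + r)
                      (∣-resp (unfactor x (+ r) a) (∣m∣n⇒∣m-n f p∣r²-a)))
                    λ { (inj₁ d) → ¬d d ; (inj₂ e) → ¬e e }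
      where
      unfactor : ∀ x r a → x * x - a - (r * r - a) ≡ (x - r) * (x - - r)
      unfactor = solve-∀

  -- Read off from `sqrt-count`: the number of roots of x² ≡ a depends only on the class of a.
  χ-periodic : Periodic p χ
  χ-periodic a b d = +-cancelˡ 1ℤ (χ a) (χ b) (begin
    1ℤ + χ a                             ≡⟨ sqrt-count a ⟨
    (∑[ x < p ] δ p (+ x * + x - a))     ≡⟨ ∑-ext p (λ x → δ-periodic p (+ x * + x - a) (+ x * + x - b)
                                              (∣-resp (shape (+ x) a b) (∣-flip a b d))) ⟩
    (∑[ x < p ] δ p (+ x * + x - b))     ≡⟨ sqrt-count b ⟩
    1ℤ + χ b                             ∎)
    where
    shape : ∀ x a b → b - a ≡ x * x - a - (x * x - b)
    shape = solve-∀

  -- Counts the pairs (b, x) with x² ≡ s b in two ways. Each b has 1 + χ(s b) partners, and each x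
  -- has exactly one because s is its own inverse.
  ∑χ≡0 : ∀ s → s * s ≡ 1ℤ → (∑[ b < p ] χ (s * + b)) ≡ 0ℤ
  ∑χ≡0 s ss≡1 = +-cancelˡ (+ p) _ 0ℤ (begin
    + p + (∑[ b < p ] χ (s * + b))
      ≡⟨ cong (_+ (∑[ b < p ] χ (s * + b))) (trans (∑-const p 1ℤ) (ℤ.*-identityʳ (+ p))) ⟨
    (∑[ b < p ] 1ℤ) + (∑[ b < p ] χ (s * + b))
      ≡⟨ ∑-+ p (λ _ → 1ℤ) (λ b → χ (s * + b)) ⟨
    (∑[ b < p ] (1ℤ + χ (s * + b)))
      ≡⟨ ∑-ext p (λ b → sqrt-count (s * + b)) ⟨
    (∑[ b < p ] ∑[ x < p ] δ p (+ x * + x - s * + b))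
      ≡⟨ ∑-swap p p (λ b x → δ p (+ x * + x - s * + b)) ⟩
    (∑[ x < p ] ∑[ b < p ] δ p (+ x * + x - s * + b))
      ≡⟨ ∑-ext p (λ x → trans
           (∑-ext p λ b → cong (λ t → δ p (+ x * + x + t)) (ℤ.neg-distribˡ-* s (+ b)))
           (∑δ-affine p (- s) (- s) (+ x * + x)
             (∣-resp (trans (sym (cong (_- 1ℤ) ss≡1)) (shape s)) (∣ᵤ⇒∣ (p ℕ.∣0))))) ⟩
    (∑[ x < p ] 1ℤ)
      ≡⟨ trans (∑-const p 1ℤ) (ℤ.*-identityʳ (+ p)) ⟩
    + p
      ≡⟨ ℤ.+-identityʳ (+ p) ⟨
    + p + 0ℤ  ∎)
    where
    shape : ∀ s → s * s - 1ℤ ≡ (- s) * (- s) - 1ℤ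
    shape = solve-∀

  -- Counts the points of the conic y² = x² - a after the shear y ↦ x + y,
  -- which makes the equation linear in x.
  ∑χ[x²-a] : ∀ a → (∑[ x < p ] χ (+ x * + x - a)) ≡ + p * δ p a - 1ℤ
  ∑χ[x²-a] a = +-cancelˡ (+ p) _ _ (begin
    + p + (∑[ x < p ] χ (+ x * + x - a))
      ≡⟨ cong (_+ (∑[ x < p ] χ (+ x * + x - a))) (trans (∑-const p 1ℤ) (ℤ.*-identityʳ (+ p))) ⟨
    (∑[ x < p ] 1ℤ) + (∑[ x < p ] χ (+ x * + x - a))
      ≡⟨ ∑-+ p (λ _ → 1ℤ) (λ x → χ (+ x * + x - a)) ⟨
    (∑[ x < p ] (1ℤ + χ (+ x * + x - a)))
      ≡⟨ ∑-ext p (λ x → sqrt-count (+ x * + x - a)) ⟨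
    (∑[ x < p ] ∑[ y < p ] δ p (+ y * + y - (+ x * + x - a)))
      ≡⟨ ∑-ext p (λ x → sym (∑-reindex p (conic-periodic (+ x * + x - a)) 1ℤ 1ℤ (+ x) (n∣1-1 p))) ⟩
    (∑[ x < p ] ∑[ y < p ] δ p ((+ x + 1ℤ * + y) * (+ x + 1ℤ * + y) - (+ x * + x - a)))
      ≡⟨ ∑-swap p p (λ x y → δ p ((+ x + 1ℤ * + y) * (+ x + 1ℤ * + y) - (+ x * + x - a))) ⟩
    (∑[ y < p ] ∑[ x < p ] δ p ((+ x + 1ℤ * + y) * (+ x + 1ℤ * + y) - (+ x * + x - a)))
      ≡⟨ ∑-ext p (λ y → trans (∑-ext p λ x → cong (δ p) (shear (+ x) (+ y) a)) (line y)) ⟩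
    (∑[ y < p ] (1ℤ + δ p (+ y) * (+ p * δ p a - 1ℤ)))
      ≡⟨ ∑-+ p (λ _ → 1ℤ) (λ y → δ p (+ y) * (+ p * δ p a - 1ℤ)) ⟩
    (∑[ y < p ] 1ℤ) + (∑[ y < p ] (δ p (+ y) * (+ p * δ p a - 1ℤ)))
      ≡⟨ cong₂ _+_ (trans (∑-const p 1ℤ) (ℤ.*-identityʳ (+ p)))
           (trans (∑-*ʳ p (+ p * δ p a - 1ℤ) (λ y → δ p (+ y)))
             (trans (cong (_* (+ p * δ p a - 1ℤ)) ∑δ-at-0) (ℤ.*-identityˡ _))) ⟩
    + p + (+ p * δ p a - 1ℤ)  ∎)
    where
    conic-periodic : ∀ b → Periodic p (λ y → δ p (y * y - b))
    conic-periodic b y z d = δ-periodic p (y * y - b) (z * z - b)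
      (∣-resp (shape y z b) (square-periodic y z d))
      where
      shape : ∀ y z b → y * y - z * z ≡ y * y - b - (z * z - b)
      shape = solve-∀
    shear : ∀ x y a → (x + 1ℤ * y) * (x + 1ℤ * y) - (x * x - a) ≡ (a + y * y) + (+ 2 * y) * x
    shear = solve-∀
    -- If p ∣ y the equation no longer involves x and contributes p solutions or none; otherwise its
    -- slope 2y is invertible and there is exactly one.
    line : ∀ y → (∑[ x < p ] δ p ((a + + y * + y) + (+ 2 * + y) * + x))
                 ≡ 1ℤ + δ p (+ y) * (+ p * δ p a - 1ℤ)
    line y with + p ∣? + y
    ... | yes p∣y = begin
      (∑[ x < p ] δ p ((a + + y * + y) + (+ 2 * + y) * + x))
        ≡⟨ ∑-ext p (λ x → δ-periodic p (a + + y * + y + + 2 * + y * + x) a (∣-resp (factor a (+ y) (+ x)) (∣m⇒∣m*n (+ y + + 2 * + x) p∣y))) ⟩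
      (∑[ x < p ] δ p a)             ≡⟨ ∑-const p (δ p a) ⟩
      + p * δ p a                    ≡⟨ shape (+ p * δ p a) ⟩
      1ℤ + 1ℤ * (+ p * δ p a - 1ℤ)   ∎
      where
      factor : ∀ a y x → y * (y + + 2 * x) ≡ a + y * y + + 2 * y * x - a
      factor = solve-∀
      shape : ∀ q → q ≡ 1ℤ + 1ℤ * (q - 1ℤ)
      shape = solve-∀
    ... | no p∤y = ∑δ-affine p u (+ 2 * + y) (a + + y * + y) u-inv
      where
      p∤2y : ¬ + p ∣ + 2 * + y
      p∤2y d with euclid (+ 2) (+ y) d
      ... | inj₁ p∣2 = p∤2 p∣2
      ... | inj₂ p∣y = p∤y p∣y
      u = proj₁ (inverse (+ 2 * + y) p∤2y)
      u-inv = proj₂ (inverse (+ 2 * + y) p∤2y)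

  has-root⇒χ≡1 : ∀ a z → ¬ + p ∣ a → + p ∣ z * z - a → χ a ≡ 1ℤ
  has-root⇒χ≡1 a z p∤a root with χ a | view a
  ... | _ | divisible p∣a       = contradiction p∣a p∤a
  ... | _ | square _ _ _        = refl
  ... | _ | nonsquare _ no-root with residue-root p z a root
  ...   | r , r<p , root′       = contradiction root′ (no-root r r<p)

  ∤-neg : ∀ a → ¬ + p ∣ a → ¬ + p ∣ - a
  ∤-neg a p∤a d = p∤a (∣-resp (ℤ.neg-involutive a) (∣m⇒∣-m d))

  χ≡0 : ∀ a → + p ∣ a → χ a ≡ 0ℤ
  χ≡0 a p∣a with χ a | view a
  ... | _ | divisible _     = refl
  ... | _ | square p∤a _ _  = contradiction p∣a p∤a
  ... | _ | nonsquare p∤a _ = contradiction p∣a p∤a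

  χ≡±1 : ∀ a → ¬ + p ∣ a → χ a ≡ 1ℤ ⊎ χ a ≡ -1ℤ
  χ≡±1 a p∤a with χ a | view a
  ... | _ | divisible p∣a = contradiction p∣a p∤a
  ... | _ | square _ _ _  = inj₁ refl
  ... | _ | nonsquare _ _ = inj₂ refl

  root-of-neg : ∀ w r b → + p ∣ w * w - -1ℤ → + p ∣ r * r - b → + p ∣ (w * r) * (w * r) - (- b)
  root-of-neg w r b dw dr = ∣-resp (sym (shape w r b))
    (∣m∣n⇒∣m+n (∣n⇒∣m*n (w * w) dr) (∣n⇒∣m*n b dw))
    where
    shape : ∀ w r b → (w * r) * (w * r) - (- b) ≡ w * w * (r * r - b) + b * (w * w - (- 1ℤ))
    shape = solve-∀

  -- If b and - b were both nonzero squares then so would be - 1.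
  χ[b]+χ[-b]≤0 : χ -1ℤ ≡ -1ℤ → ∀ b → χ b + χ (- b) ℤ.≤ 0ℤ
  χ[b]+χ[-b]≤0 χ[-1]≡-1 b with χ b | view b
  ... | _ | divisible p∣b rewrite χ≡0 (- b) (∣m⇒∣-m p∣b) = ℤ.≤-refl
  ... | _ | nonsquare p∤b _ with χ≡±1 (- b) (∤-neg b p∤b)
  ...   | inj₁ e rewrite e = ℤ.≤-refl
  ...   | inj₂ e rewrite e = ℤ.-≤+
  χ[b]+χ[-b]≤0 χ[-1]≡-1 b | _ | square p∤b r dr with χ (- b) | view (- b)
  ...   | _ | divisible p∣-b = contradiction p∣-b (∤-neg b p∤b)
  ...   | _ | nonsquare _ _  = ℤ.≤-refl
  ...   | _ | square _ s ds  = contradiction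
    (trans (sym χ[-1]≡-1) (has-root⇒χ≡1 -1ℤ (+ s * u) (∤-neg 1ℤ p∤1) root)) λ ()
    where
    p∤r : ¬ + p ∣ + r
    p∤r d = p∤b (square-root-∣ (+ r) b dr d)
    u = proj₁ (inverse (+ r) p∤r)
    du = proj₂ (inverse (+ r) p∤r)
    -- The quotient s / r of the two roots squares to (- b) / b.
    root : + p ∣ (+ s * u) * (+ s * u) - -1ℤ
    root = ∣-resp (shape (+ s) u (+ r) b)
      (∣m∣n⇒∣m-n (∣m∣n⇒∣m+n (∣n⇒∣m*n (u * u) ds) (∣n⇒∣m*n (u * u) dr))
                 (∣m⇒∣m*n (u * + r + 1ℤ) du))
      where
      shape : ∀ s u r b → u * u * (s * s - (- b)) + u * u * (r * r - b) - (u * r - 1ℤ) * (u * r + 1ℤ)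
                          ≡ (s * u) * (s * u) - (- 1ℤ)
      shape = solve-∀

  -- If - 1 is a nonsquare, the terms χ(b) + χ(- b) are nonpositive and add up to 0 over all
  -- residues, so each of them vanishes. If - 1 ≡ w², multiplication by w carries roots of b to
  -- roots of - b and back.
  χ-neg : ∀ b → χ (- b) ≡ χ -1ℤ * χ b
  χ-neg b with χ≡±1 -1ℤ (∤-neg 1ℤ p∤1)
  χ-neg b | inj₂ e rewrite e = trans (ℤ.i-j≡0⇒i≡j (χ (- b)) (- χ b)
      (trans (shape (χ (- b)) (χ b)) χ[b]+χ[-b]≡0)) (sym (ℤ.-1*i≡-i (χ b)))
    where
    shape : ∀ x y → x - - y ≡ y + x
    shape = solve-∀
    r = proj₁ (residue p b)
    r<p = proj₁ (proj₂ (residue p b))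
    d = proj₂ (proj₂ (residue p b))
    neg-shape : ∀ b r → - (b - r) ≡ - b - - r
    neg-shape = solve-∀
    total : (∑[ x < p ] (χ (+ x) + χ (- + x))) ≡ 0ℤ
    total = trans (∑-+ p (λ x → χ (+ x)) (λ x → χ (- + x)))
      (cong₂ _+_ (trans (∑-ext p λ x → cong χ (sym (ℤ.*-identityˡ (+ x)))) (∑χ≡0 1ℤ refl))
                 (trans (∑-ext p λ x → cong χ (sym (ℤ.-1*i≡-i (+ x)))) (∑χ≡0 -1ℤ refl)))
    χ[b]+χ[-b]≡0 : χ b + χ (- b) ≡ 0ℤ
    χ[b]+χ[-b]≡0 = trans
      (cong₂ _+_ (χ-periodic b (+ r) d)
                 (χ-periodic (- b) (- + r) (∣-resp (neg-shape b (+ r)) (∣m⇒∣-m d))))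
      (∑-nonpos-zero p (λ x → χ (+ x) + χ (- + x)) (λ x _ → χ[b]+χ[-b]≤0 e (+ x)) total r r<p)
  χ-neg b | inj₁ e with χ -1ℤ | view -1ℤ
  χ-neg b | inj₁ () | _ | divisible _
  χ-neg b | inj₁ () | _ | nonsquare _ _
  χ-neg b | inj₁ _  | _ | square _ w dw = trans (χ[-b]≡χ[b] b) (sym (ℤ.*-identityˡ (χ b)))
    where
    χ[-b]≡χ[b] : ∀ b → χ (- b) ≡ χ b
    χ[-b]≡χ[b] b with χ b | view b
    ... | _ | divisible p∣b   = χ≡0 (- b) (∣m⇒∣-m p∣b)
    ... | _ | square p∤b r dr = has-root⇒χ≡1 (- b) (+ w * + r) (∤-neg b p∤b) (root-of-neg (+ w) (+ r) b dw dr)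
    ... | _ | nonsquare p∤b no-root with χ (- b) | view (- b)
    ...   | _ | divisible p∣-b = contradiction p∣-b (∤-neg b p∤b)
    ...   | _ | nonsquare _ _  = refl
    ...   | _ | square p∤-b s ds with residue-root p (+ w * + s) b
              (∣-resp (cong (λ t → (+ w * + s) * (+ w * + s) - t) (ℤ.neg-involutive b))
                      (root-of-neg (+ w) (+ s) (- b) dw ds))
    ...     | r , r<p , root = contradiction root (no-root r r<p)

  -- ∑ χ(x² - 1) = - 1 consists of χ(- 1), the two zeros x = ± 1, and p - 3 units paired by x ↦ - x,
  -- so χ(- 1) is determined modulo 4.
  χ[-1] : χ -1ℤ ≡ sgn h
  χ[-1] = by-parity h p≡1+2h
    where
    g : ℕ → ℤ
    g x = χ (+ x * + x - 1ℤ)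
    ∑g : ∑< p g ≡ -1ℤ
    ∑g = trans (∑χ[x²-a] 1ℤ) (trans (cong (λ t → + p * t - 1ℤ) (⟦⟧-no (+ p ∣? 1ℤ) p∤1))
               (cong (_- 1ℤ) (ℤ.*-zeroʳ (+ p))))
    symmetric : ∀ i j → i ℕ.+ j ≡ p → g i ≡ g j
    symmetric i j i+j≡p = χ-periodic (+ i * + i - 1ℤ) (+ j * + j - 1ℤ)
      (∣-resp (shape (+ i) (+ j)) (∣n⇒∣m*n (+ i - + j) (subst (λ s → + p ∣ + s) (sym i+j≡p) ∣-refl)))
      where
      shape : ∀ i j → (i - j) * (i + j) ≡ i * i - 1ℤ - (j * j - 1ℤ)
      shape = solve-∀
    by-parity : ∀ h → p ≡ suc (h ℕ.+ h) → χ -1ℤ ≡ sgn h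
    by-parity zero     p≡1 = contradiction (subst Prime p≡1 p-prime) ¬prime[1]
    by-parity (suc h′) p≡ = conclude (χ≡±1 -1ℤ (∤-neg 1ℤ p∤1))
      where
      -- These are the terms x = 2, ..., h. Both factors of x² - 1 = (x - 1)(x + 1) lie strictly
      -- between 0 and p, so χ takes a value ± 1, which is odd.
      units-odd : ∀ i → i < h′ → ∃[ t ] (g (suc (suc i)) ≡ 1ℤ + + 2 * t)
      units-odd i i<h′ with χ≡±1 (+ suc (suc i) * + suc (suc i) - 1ℤ) p∤x²-1
        where
        i<h : suc i < suc h′
        i<h = s≤s i<h′
        factor : ∀ i → (1ℤ + (1ℤ + i)) * (1ℤ + (1ℤ + i)) - 1ℤ ≡ (1ℤ + i) * (1ℤ + (1ℤ + (1ℤ + i)))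
        factor = solve-∀
        p∤x²-1 : ¬ + p ∣ + suc (suc i) * + suc (suc i) - 1ℤ
        p∤x²-1 d with euclid (+ suc i) (+ suc (suc (suc i))) (∣-resp (factor (+ i)) d)
        ... | inj₁ e = p∤small i (subst (suc i <_) (sym p≡) (ℕ.m≤n⇒m≤1+n (ℕ.m≤n⇒m≤n+o (suc h′) i<h))) e
        ... | inj₂ e = p∤small (suc (suc i)) (subst (suc (suc (suc i)) <_) (sym p≡)
                         (s≤s (subst (3 ℕ.+ i ≤_) (ℕ.+-comm (suc h′) (suc h′))
                           (ℕ.≤-trans (s≤s i<h) (ℕ.+-monoˡ-≤ (suc h′) (s≤s z≤n)))))) e
      ... | inj₁ e = 0ℤ , e
      ... | inj₂ e = -1ℤ , e
      t = proj₁ (∑-odd h′ (g ∘ suc ∘ suc) units-odd)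
      S = ∑< h′ (g ∘ suc ∘ suc)
      g1≡0 : g 1 ≡ 0ℤ
      g1≡0 = χ≡0 0ℤ (∣ᵤ⇒∣ (p ℕ.∣0))
      -- The range splits into x = 0, which gives χ(- 1), and two mirror halves of length h. In each
      -- half the end with x = ± 1 contributes 0 and the other h′ = h - 1 terms sum to h′ + 2t.
      halves : χ -1ℤ + + 2 * (+ h′ + + 2 * t) ≡ -1ℤ
      halves = begin
        χ -1ℤ + + 2 * (+ h′ + + 2 * t)
          ≡⟨ cong (λ s → χ -1ℤ + + 2 * s) (proj₂ (∑-odd h′ (g ∘ suc ∘ suc) units-odd)) ⟨
        χ -1ℤ + + 2 * S
          ≡⟨ cong (_+_ (χ -1ℤ)) (double S) ⟩
        χ -1ℤ + ((0ℤ + S) + (0ℤ + S))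
          ≡⟨ cong (λ s → χ -1ℤ + ((s + S) + (s + S))) g1≡0 ⟨
        χ -1ℤ + (∑< (suc h′) (g ∘ suc) + ∑< (suc h′) (g ∘ suc))
          ≡⟨ cong (_+_ (χ -1ℤ)) (∑-fold (suc h′) (g ∘ suc) λ i j e →
               symmetric (suc i) (suc j) (trans (cong suc (trans (ℕ.+-suc i j) e)) (sym p≡))) ⟨
        ∑< (suc (suc h′ ℕ.+ suc h′)) g
          ≡⟨ cong (λ n → ∑< n g) p≡ ⟨
        ∑< p g
          ≡⟨ ∑g ⟩
        -1ℤ ∎
        where
        double : ∀ s → + 2 * s ≡ (0ℤ + s) + (0ℤ + s)
        double = solve-∀
      -- Solving `halves` for h: χ(- 1) = 1 forces h = - 2t, and χ(- 1) = - 1 forces h - 1 = - 2t.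
      conclude : χ -1ℤ ≡ 1ℤ ⊎ χ -1ℤ ≡ -1ℤ → χ -1ℤ ≡ sgn (suc h′)
      conclude (inj₁ e) = trans e (sym (sgn-even (suc h′) (- t)
        (ℤ.*-cancelˡ-≡ (+ 2) (+ suc h′) (+ 2 * - t) (ℤ.i-j≡0⇒i≡j _ _ (begin
          + 2 * (1ℤ + + h′) - + 2 * (+ 2 * - t)   ≡⟨ shape (+ h′) t ⟩
          (1ℤ + + 2 * (+ h′ + + 2 * t)) - -1ℤ     ≡⟨ cong (λ s → s + + 2 * (+ h′ + + 2 * t) - -1ℤ) e ⟨
          (χ -1ℤ + + 2 * (+ h′ + + 2 * t)) - -1ℤ  ≡⟨ cong (_- -1ℤ) halves ⟩
          0ℤ ∎)))))
        where
        shape : ∀ h t → + 2 * (1ℤ + h) - + 2 * (+ 2 * - t) ≡ (1ℤ + + 2 * (h + + 2 * t)) - (- 1ℤ)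
        shape = solve-∀
      conclude (inj₂ e) = trans e (cong (-1ℤ *_) (sym (sgn-even h′ (- t)
        (ℤ.*-cancelˡ-≡ (+ 2) (+ h′) (+ 2 * - t) (ℤ.i-j≡0⇒i≡j _ _ (begin
          + 2 * + h′ - + 2 * (+ 2 * - t)          ≡⟨ shape (+ h′) t ⟩
          (-1ℤ + + 2 * (+ h′ + + 2 * t)) - -1ℤ    ≡⟨ cong (λ s → s + + 2 * (+ h′ + + 2 * t) - -1ℤ) e ⟨
          (χ -1ℤ + + 2 * (+ h′ + + 2 * t)) - -1ℤ  ≡⟨ cong (_- -1ℤ) halves ⟩
          0ℤ ∎))))))
        where
        shape : ∀ h t → + 2 * h - + 2 * (+ 2 * - t) ≡ ((- 1ℤ) + + 2 * (h + + 2 * t)) - (- 1ℤ)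
        shape = solve-∀

  ε : ℤ
  ε = sgn h

  ∑χ[a-x²] : ∀ a → (∑[ x < p ] χ (a - + x * + x)) ≡ ε * (+ p * δ p a - 1ℤ)
  ∑χ[a-x²] a = begin
    (∑[ x < p ] χ (a - + x * + x))
      ≡⟨ ∑-ext p (λ x → trans (cong χ (flip a (+ x * + x))) (χ-neg (+ x * + x - a))) ⟩
    (∑[ x < p ] (χ -1ℤ * χ (+ x * + x - a)))
      ≡⟨ ∑-*ˡ p (χ -1ℤ) (λ x → χ (+ x * + x - a)) ⟩
    χ -1ℤ * (∑[ x < p ] χ (+ x * + x - a))
      ≡⟨ cong₂ _*_ χ[-1] (∑χ[x²-a] a) ⟩
    ε * (+ p * δ p a - 1ℤ)  ∎
    where
    flip : ∀ a y → a - y ≡ - (y - a)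
    flip = solve-∀

  ∑δ[a-x²] : ∀ a → (∑[ x < p ] (+ p * δ p (a - + x * + x) - 1ℤ)) ≡ + p * χ a
  ∑δ[a-x²] a = begin
    (∑[ x < p ] (+ p * δ p (a - + x * + x) - 1ℤ))
      ≡⟨ ∑-- p (λ x → + p * δ p (a - + x * + x)) (λ _ → 1ℤ) ⟩
    (∑[ x < p ] (+ p * δ p (a - + x * + x))) - (∑[ x < p ] 1ℤ)
      ≡⟨ cong₂ _-_ (trans (∑-*ˡ p (+ p) (λ x → δ p (a - + x * + x)))
           (cong (+ p *_) (trans (∑-ext p λ x → δ-flip p a (+ x * + x)) (sqrt-count a))))
           (∑-const p 1ℤ) ⟩
    + p * (1ℤ + χ a) - + p * 1ℤ
      ≡⟨ shape (+ p) (χ a) ⟩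
    + p * χ a  ∎
    where
    shape : ∀ p c → p * (1ℤ + c) - p * 1ℤ ≡ p * c
    shape = solve-∀

-- Sums over lists and counting by indicators

⟦⟧-× : {P Q R : Set} (r? : Dec R) (p? : Dec P) (q? : Dec Q) → (R → P × Q) → (P × Q → R) →
       ⟦ r? ⟧ ≡ ⟦ p? ⟧ * ⟦ q? ⟧
⟦⟧-× r? (yes p) (yes q) f g = ⟦⟧-yes r? (g (p , q))
⟦⟧-× r? (yes p) (no ¬q) f g = ⟦⟧-no r? (¬q ∘ proj₂ ∘ f)
⟦⟧-× r? (no ¬p) q?      f g = trans (⟦⟧-no r? (¬p ∘ proj₁ ∘ f)) (sym (ℤ.*-zeroˡ ⟦ q? ⟧))

private variable
  X Y : Set

-- This is exactly the `foldr` inside `sumTo` and `sumToWhere`, so both are instances of it by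
-- definition.
∑ₗ : List X → (X → ℤ) → ℤ
∑ₗ xs f = foldr (λ x s → f x + s) 0ℤ xs

∑ₗ-ext : ∀ (xs : List X) {f g} → (∀ x → f x ≡ g x) → ∑ₗ xs f ≡ ∑ₗ xs g
∑ₗ-ext []       f≗g = refl
∑ₗ-ext (x ∷ xs) f≗g = cong₂ _+_ (f≗g x) (∑ₗ-ext xs f≗g)

∑ₗ-++ : ∀ (xs ys : List X) f → ∑ₗ (xs ++ ys) f ≡ ∑ₗ xs f + ∑ₗ ys f
∑ₗ-++ []       ys f = sym (ℤ.+-identityˡ _)
∑ₗ-++ (x ∷ xs) ys f = trans (cong (_+_ (f x)) (∑ₗ-++ xs ys f)) (sym (ℤ.+-assoc (f x) _ _))

∑ₗ-concatMap : ∀ (g : X → List Y) xs f → ∑ₗ (concatMap g xs) f ≡ ∑ₗ xs (λ x → ∑ₗ (g x) f)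
∑ₗ-concatMap g []       f = refl
∑ₗ-concatMap g (x ∷ xs) f = trans (∑ₗ-++ (g x) (concatMap g xs) f)
                                  (cong (_+_ (∑ₗ (g x) f)) (∑ₗ-concatMap g xs f))

∑ₗ-map : ∀ (g : X → Y) xs f → ∑ₗ (map g xs) f ≡ ∑ₗ xs (f ∘ g)
∑ₗ-map g []       f = refl
∑ₗ-map g (x ∷ xs) f = cong (_+_ (f (g x))) (∑ₗ-map g xs f)

∑ₗ-*ˡ : ∀ c (xs : List X) f → ∑ₗ xs (λ x → c * f x) ≡ c * ∑ₗ xs f
∑ₗ-*ˡ c []       f = sym (ℤ.*-zeroʳ c)
∑ₗ-*ˡ c (x ∷ xs) f = trans (cong (_+_ (c * f x)) (∑ₗ-*ˡ c xs f)) (sym (ℤ.*-distribˡ-+ c (f x) _))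

∑ₗ-filter : ∀ {P : X → Set} (P? : ∀ x → Dec (P x)) xs f →
            ∑ₗ (filter P? xs) f ≡ ∑ₗ xs (λ x → ⟦ P? x ⟧ * f x)
∑ₗ-filter P? []       f = refl
∑ₗ-filter P? (x ∷ xs) f with P? x
... | yes _ = cong₂ _+_ (sym (ℤ.*-identityˡ (f x))) (∑ₗ-filter P? xs f)
... | no  _ = trans (∑ₗ-filter P? xs f) (sym (ℤ.+-identityˡ _))

length-filter : ∀ {P : X → Set} (P? : ∀ x → Dec (P x)) xs →
                + length (filter P? xs) ≡ ∑ₗ xs (λ x → ⟦ P? x ⟧)
length-filter P? []       = refl
length-filter P? (x ∷ xs) with P? x
... | yes _ = cong (_+_ 1ℤ) (length-filter P? xs)
... | no  _ = trans (length-filter P? xs) (sym (ℤ.+-identityˡ _))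

∑ₗ-tabulate : ∀ n (g : Fin n → X) f → ∑ₗ (tabulate g) f ≡ CM.sum (f ∘ g)
∑ₗ-tabulate zero    g f = refl
∑ₗ-tabulate (suc n) g f = cong (_+_ (f (g Fin.zero))) (∑ₗ-tabulate n (g ∘ Fin.suc) f)

∑ₗ-upTo : ∀ n f → ∑ₗ (upTo n) f ≡ ∑< n f
∑ₗ-upTo n f = go n id
  where
  go : ∀ n g → ∑ₗ (applyUpTo g n) f ≡ ∑< n (f ∘ g)
  go zero    g = refl
  go (suc n) g = cong (_+_ (f (g 0))) (go n (g ∘ suc))

-- Exceptional units

Unit : ℕ → ℤ → Set
Unit n a = Coprime n ∣ a ∣

unit-resp : ∀ {n} a b → + n ∣ a - b → Unit n a → Unit n b
unit-resp a b n∣a-b unit {d} (d∣n , d∣b) = unit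
  (d∣n , ∣⇒∣ᵤ (∣-transport a b (∣-trans (∣ᵤ⇒∣ {+ d} d∣n) n∣a-b) (∣ᵤ⇒∣ d∣b)))

unit-∣ : ∀ {m n} a → m ℕ.∣ n → Unit n a → Unit m a
unit-∣ a m∣n unit (d∣m , d∣a) = unit (ℕ.∣-trans d∣m m∣n , d∣a)

unit-* : ∀ {m n} a → Unit m a → Unit n a → Unit (m ℕ.* n) a
unit-* a unit-m unit-n {d} (d∣mn , d∣a) =
  unit-n (coprime-divisor (λ { (i∣d , i∣m) → unit-m (i∣m , ℕ.∣-trans i∣d d∣a) }) d∣mn , d∣a)

Exceptional : ℕ → ℤ → Set
Exceptional n a = Unit n a × Unit n (1ℤ - a)

exceptional? : ∀ n a → Dec (Exceptional n a)
exceptional? n a = coprime? n ∣ a ∣ ×-dec coprime? n ∣ 1ℤ - a ∣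

e : ℕ → ℤ → ℤ
e n a = ⟦ exceptional? n a ⟧

exceptional-resp : ∀ {n} a b → + n ∣ a - b → Exceptional n a → Exceptional n b
exceptional-resp a b d (u , v) =
  unit-resp a b d u , unit-resp (1ℤ - a) (1ℤ - b) (∣-resp (shape a b) (∣-flip a b d)) v
  where
  shape : ∀ a b → b - a ≡ 1ℤ - a - (1ℤ - b)
  shape = solve-∀

e-periodic : ∀ n → Periodic n (e n)
e-periodic n a b d = ⟦⟧-cong (exceptional? n a) (exceptional? n b)
  (exceptional-resp a b d) (exceptional-resp b a (∣-flip a b d))

exceptional-∣ : ∀ {m n} a → m ℕ.∣ n → Exceptional n a → Exceptional m a
exceptional-∣ a m∣n (u , v) = unit-∣ a m∣n u , unit-∣ (1ℤ - a) m∣n v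

exceptional-* : ∀ {m n} a → Exceptional m a → Exceptional n a → Exceptional (m ℕ.* n) a
exceptional-* a (u , v) (u′ , v′) = unit-* a u u′ , unit-* (1ℤ - a) v v′

e-* : ∀ m n a → e (m ℕ.* n) a ≡ e m a * e n a
e-* m n a = ⟦⟧-× (exceptional? (m ℕ.* n) a) (exceptional? m a) (exceptional? n a)
  (λ x → exceptional-∣ a (ℕ.m∣m*n n) x , exceptional-∣ a (ℕ.n∣m*n m) x)
  (λ { (x , y) → exceptional-* a x y })

-- One of a and 1 - a is even.
¬exceptional-even : ∀ {n} a → 2 ℕ.∣ n → ¬ Exceptional n a
¬exceptional-even a 2∣n (u , v) with residue 2 a
... | 0 , _ , d = contradiction (u (2∣n , ∣⇒∣ᵤ (∣-resp (ℤ.+-identityʳ a) d))) λ ()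
... | 1 , _ , d = contradiction (v (2∣n , ∣⇒∣ᵤ (∣-flip a 1ℤ d))) λ ()
... | suc (suc _) , s≤s (s≤s ()) , _

-- The recursion fixes one coordinate x and passes the target a - x² on to the others; the empty
-- tuple has sum 0, whence `δ n`. With a target ranging over ℤ, each step is a linear operator on
-- periodic functions.
W : ℕ → ℕ → ℤ → ℤ
W n zero    a = δ n a
W n (suc k) a = ∑[ x < n ] (e n (+ x) * W n k (a - + x * + x))

∑ₗ-allVecs : ∀ n k c → ∑ₗ (allVecs n k) (λ v → ⟦ counted? n c v ⟧) ≡ W n k c
∑ₗ-allVecs n zero c = trans (ℤ.+-identityʳ _)
  (⟦⟧-cong (counted? n c []) (+ n ∣? c)
    (λ { (_ , d) → ∣-resp (shape c) (∣m⇒∣-m (∣ᵤ⇒∣ d)) })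
    (λ d → [] , ∣⇒∣ᵤ (∣-resp (shape′ c) (∣m⇒∣-m d))))
  where
  shape : ∀ c → - (0ℤ - c) ≡ c
  shape = solve-∀
  shape′ : ∀ c → - c ≡ 0ℤ - c
  shape′ = solve-∀
∑ₗ-allVecs n (suc k) c = begin
  ∑ₗ (concatMap (λ x → map (x ∷_) (allVecs n k)) (allFin n)) (λ v → ⟦ counted? n c v ⟧)
    ≡⟨ ∑ₗ-concatMap (λ x → map (x ∷_) (allVecs n k)) (allFin n) (λ v → ⟦ counted? n c v ⟧) ⟩
  ∑ₗ (allFin n) (λ x → ∑ₗ (map (x ∷_) (allVecs n k)) (λ v → ⟦ counted? n c v ⟧))
    ≡⟨ ∑ₗ-ext (allFin n) (λ x → trans (∑ₗ-map (x ∷_) (allVecs n k) (λ v → ⟦ counted? n c v ⟧))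
         (trans (∑ₗ-ext (allVecs n k) (split x))
                (∑ₗ-*ˡ (e n (+ toℕ x)) (allVecs n k)
                  (λ v → ⟦ counted? n (c - + toℕ x * + toℕ x) v ⟧)))) ⟩
  ∑ₗ (allFin n) (λ x → e n (+ toℕ x) * ∑ₗ (allVecs n k) (λ v → ⟦ counted? n (c - + toℕ x * + toℕ x) v ⟧))
    ≡⟨ ∑ₗ-ext (allFin n) (λ x → cong (e n (+ toℕ x) *_) (∑ₗ-allVecs n k (c - + toℕ x * + toℕ x))) ⟩
  ∑ₗ (allFin n) (λ x → e n (+ toℕ x) * W n k (c - + toℕ x * + toℕ x))
    ≡⟨ ∑ₗ-tabulate n id _ ⟩
  W n (suc k) c  ∎
  where
  shape : ∀ q s c → q + s - c ≡ s - (c - q)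
  shape = solve-∀
  to : ∀ x → IsExceptional n x → Exceptional n (+ toℕ x)
  to x (u , v) = Coprime.sym (Coprime.gcd≡1⇒coprime u)
               , Coprime.sym (Coprime.gcd≡1⇒coprime (ℤ.+-injective v))
  from : ∀ x → Exceptional n (+ toℕ x) → IsExceptional n x
  from x (u , v) = Coprime.coprime⇒gcd≡1 (Coprime.sym u)
                 , cong (λ m → + m) (Coprime.coprime⇒gcd≡1 (Coprime.sym v))
  split : ∀ x v → ⟦ counted? n c (x ∷ v) ⟧
                  ≡ e n (+ toℕ x) * ⟦ counted? n (c - + toℕ x * + toℕ x) v ⟧
  split x v = ⟦⟧-× (counted? n c (x ∷ v)) (exceptional? n (+ toℕ x)) (counted? n (c - + toℕ x * + toℕ x) v)
    (λ { (ex ∷ exs , d) → to x ex , exs ,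
         subst (λ s → n ℕ.∣ ∣ s ∣) (shape (+ toℕ x * + toℕ x) (sumSq v) c) d })
    (λ { (ex , exs , d) → from x ex ∷ exs ,
         subst (λ s → n ℕ.∣ ∣ s ∣) (sym (shape (+ toℕ x * + toℕ x) (sumSq v) c)) d })

N2≡W : ∀ n k c → + N2 k c n ≡ W n k c
N2≡W n k c = trans (length-filter (counted? n c) (allVecs n k)) (∑ₗ-allVecs n k c)

W-even : ∀ n k c → 2 ℕ.∣ n → W n (suc k) c ≡ 0ℤ
W-even n k c 2∣n = trans
  (∑-ext n λ x → trans (cong (_* W n k (c - + x * + x)) (⟦⟧-no (exceptional? n (+ x)) (¬exceptional-even (+ x) 2∣n)))
                       (ℤ.*-zeroˡ (W n k (c - + x * + x))))
  (∑-zero n)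

∣-minus : ∀ {n} a b c → + n ∣ a - b → + n ∣ (a - c) - (b - c)
∣-minus a b c = ∣-resp (shape a b c)
  where
  shape : ∀ a b c → a - b ≡ (a - c) - (b - c)
  shape = solve-∀

W-periodic : ∀ n k → Periodic n (W n k)
W-periodic n zero    a b d = δ-periodic n a b d
W-periodic n (suc k) a b d = ∑-ext n λ x →
  cong (e n (+ x) *_) (W-periodic n k (a - + x * + x) (b - + x * + x) (∣-minus a b (+ x * + x) d))

∣-minus-square : ∀ {n} a x y → + n ∣ x - y → + n ∣ (a - x * x) - (a - y * y)
∣-minus-square a x y d = ∣-resp (shape a x y) (square-periodic y x (∣-flip x y d))
  where
  shape : ∀ a x y → y * y - x * x ≡ (a - x * x) - (a - y * y)
  shape = solve-∀

-- Chinese remainder theorem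

-- In x = y + m z the function g sees only y. For fixed y, the number y + m z runs through all
-- residues modulo n, since m is invertible there, so the inner sum no longer depends on y.
∑-CRT : ∀ n m .{{_ : NonZero n}} {f g} → Coprime n m → Periodic n f → Periodic m g →
        (∑[ x < n ℕ.* m ] (f (+ x) * g (+ x))) ≡ (∑[ x < n ] f (+ x)) * (∑[ x < m ] g (+ x))
∑-CRT n m {f} {g} c f-per g-per = begin
  (∑[ x < n ℕ.* m ] (f (+ x) * g (+ x)))
    ≡⟨ ∑-blocks n m (λ x → f (+ x) * g (+ x)) ⟩
  (∑[ z < n ] ∑[ y < m ] (f (+ (y ℕ.+ z ℕ.* m)) * g (+ (y ℕ.+ z ℕ.* m))))
    ≡⟨ ∑-ext n (λ z → ∑-ext m λ y → cong₂ _*_ (cong f (cast y z)) (g-per (+ (y ℕ.+ z ℕ.* m)) (+ y) (multiple y z))) ⟩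
  (∑[ z < n ] ∑[ y < m ] (f (+ y + + m * + z) * g (+ y)))
    ≡⟨ ∑-swap n m (λ z y → f (+ y + + m * + z) * g (+ y)) ⟩
  (∑[ y < m ] ∑[ z < n ] (f (+ y + + m * + z) * g (+ y)))
    ≡⟨ ∑-ext m (λ y → trans (∑-*ʳ n (g (+ y)) (λ z → f (+ y + + m * + z)))
         (cong (_* g (+ y)) (∑-reindex n f-per (proj₁ m-inv) (+ m) (+ y) (proj₂ m-inv)))) ⟩
  (∑[ y < m ] ((∑[ x < n ] f (+ x)) * g (+ y)))
    ≡⟨ ∑-*ˡ m (∑[ x < n ] f (+ x)) (λ y → g (+ y)) ⟩
  (∑[ x < n ] f (+ x)) * (∑[ x < m ] g (+ x))  ∎
  where
  m-inv = coprime⇒inverse (+ m) c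
  cast : ∀ y z → + (y ℕ.+ z ℕ.* m) ≡ + y + + m * + z
  cast y z = cong (_+_ (+ y)) (trans (ℤ.pos-* z m) (ℤ.*-comm (+ z) (+ m)))
  multiple : ∀ y z → + m ∣ + (y ℕ.+ z ℕ.* m) - + y
  multiple y z = divides (+ z) (trans (cong (_- + y) (cong (_+_ (+ y)) (ℤ.pos-* z m))) (shape (+ y) (+ z * + m)))
    where
    shape : ∀ y s → y + s - y ≡ s
    shape = solve-∀

δ-CRT : ∀ n m a → Coprime n m → δ (n ℕ.* m) a ≡ δ n a * δ m a
δ-CRT n m a c = ⟦⟧-× (+ (n ℕ.* m) ∣? a) (+ n ∣? a) (+ m ∣? a)
  (λ d → ∣ᵤ⇒∣ (ℕ.∣-trans (ℕ.m∣m*n m) (∣⇒∣ᵤ d)) , ∣ᵤ⇒∣ (ℕ.∣-trans (ℕ.n∣m*n n) (∣⇒∣ᵤ d)))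
  (λ { (d , d′) → ∣ᵤ⇒∣ (both (∣⇒∣ᵤ d) (∣⇒∣ᵤ d′)) })
  where
  both : ∀ {a} → n ℕ.∣ a → m ℕ.∣ a → n ℕ.* m ℕ.∣ a
  both n∣a (ℕ.divides q refl) =
    ℕ.*-monoˡ-∣ m (coprime-divisor {n = m} c (subst (n ℕ.∣_) (ℕ.*-comm q m) n∣a))

-- Once weight and remaining count are both factored, each coordinate adds a sum of a function
-- periodic modulo n times one periodic modulo m.
W-CRT : ∀ n m .{{_ : NonZero n}} k a → Coprime n m → W (n ℕ.* m) k a ≡ W n k a * W m k a
W-CRT n m zero    a c = δ-CRT n m a c
W-CRT n m (suc k) a c = trans
  (∑-ext (n ℕ.* m) λ x → trans (cong₂ _*_ (e-* n m (+ x)) (W-CRT n m k (a - + x * + x) c))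
                               (interchange (e n (+ x)) (e m (+ x)) (W n k (a - + x * + x)) (W m k (a - + x * + x))))
  (∑-CRT n m {term n} {term m} c (term-periodic n) (term-periodic m))
  where
  interchange : ∀ p q r s → (p * q) * (r * s) ≡ (p * r) * (q * s)
  interchange = solve-∀
  term : ℕ → ℤ → ℤ
  term n x = e n x * W n k (a - x * x)
  term-periodic : ∀ n → Periodic n (term n)
  term-periodic n x y d = cong₂ _*_ (e-periodic n x y d)
    (W-periodic n k (a - x * x) (a - y * y) (∣-minus-square a x y d))

-- Binomial sums

nC0≡1 : ∀ n → n C 0 ≡ 1
nC0≡1 n = trans (nCk≡nC[n∸k] {0} {n} z≤n) (nCn≡1 n)

-- Pascal's rule under the sum. The sequence v is arbitrary because the rule is applied to both
-- expansions, in `binomialShift-suc` and in `R-suc`.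
∑-pascal : ∀ l (v : ℕ → ℤ) → (∑[ j < suc (suc l) ] (+ (suc l C j) * v j))
                   ≡ (∑[ j < suc l ] (+ (l C j) * v j)) + (∑[ j < suc l ] (+ (l C j) * v (suc j)))
∑-pascal l v = begin
  + (suc l C 0) * v 0 + (∑[ j < suc l ] (+ (suc l C suc j) * v (suc j)))
    ≡⟨ cong₂ _+_ (cong (λ n → + n * v 0) (trans (nC0≡1 (suc l)) (sym (nC0≡1 l))))
         (∑-ext (suc l) λ j → trans
           (cong (λ n → + n * v (suc j)) (sym (nCk+nC[k+1]≡[n+1]C[k+1] l j)))
           (ℤ.*-distribʳ-+ (v (suc j)) (+ (l C j)) (+ (l C suc j)))) ⟩
  + (l C 0) * v 0 + (∑[ j < suc l ] (+ (l C j) * v (suc j) + + (l C suc j) * v (suc j)))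
    ≡⟨ cong (_+_ (+ (l C 0) * v 0)) (∑-+ (suc l) (λ j → + (l C j) * v (suc j)) (λ j → + (l C suc j) * v (suc j))) ⟩
  + (l C 0) * v 0 + ((∑[ j < suc l ] (+ (l C j) * v (suc j))) + (∑[ j < suc l ] (+ (l C suc j) * v (suc j))))
    ≡⟨ shape (+ (l C 0) * v 0) _ _ ⟩
  (∑[ j < suc (suc l) ] (+ (l C j) * v j)) + (∑[ j < suc l ] (+ (l C j) * v (suc j)))
    -- The first sum runs one index too far; its last term carries `l C suc l`, which is 0.
    ≡⟨ cong (_+ (∑[ j < suc l ] (+ (l C j) * v (suc j)))) (trans
         (∑-last (suc l) (λ j → + (l C j) * v j))
         (trans (cong (λ n → ∑< (suc l) (λ j → + (l C j) * v j) + + n * v (suc l)) (k>n⇒nCk≡0 (ℕ.n<1+n l)))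
                (ℤ.+-identityʳ (∑[ j < suc l ] (+ (l C j) * v j))))) ⟩
  (∑[ j < suc l ] (+ (l C j) * v j)) + (∑[ j < suc l ] (+ (l C j) * v (suc j)))  ∎
  where
  shape : ∀ a b c → a + (b + c) ≡ (a + c) + b
  shape = solve-∀

∑-binomial : ∀ l → (∑[ j < suc l ] (+ (l C j) * 1ℤ)) ≡ + (2 ℕ.^ l)
∑-binomial zero    = refl
∑-binomial (suc l) = trans (∑-pascal l (λ _ → 1ℤ))
  (trans (cong₂ _+_ (∑-binomial l) (∑-binomial l))
         (cong (λ n → + (2 ℕ.^ l ℕ.+ n)) (sym (ℕ.+-identityʳ (2 ℕ.^ l)))))

-- The operator B^l, written out by the binomial theorem.
binomialShift : ℕ → (ℤ → ℤ) → ℤ → ℤ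
binomialShift l f a = ∑[ j < suc l ] (+ (l C j) * f (a - + j))

binomialShift-suc : ∀ l f a → binomialShift (suc l) f a ≡ binomialShift l f a + binomialShift l f (a - 1ℤ)
binomialShift-suc l f a = trans (∑-pascal l (λ j → f (a - + j)))
  (cong (_+_ (binomialShift l f a)) (∑-ext (suc l) λ j → cong (λ b → + (l C j) * f b) (shape a (+ j))))
  where
  shape : ∀ a j → a - (1ℤ + j) ≡ a - 1ℤ - j
  shape = solve-∀

∑-evens-odds : ∀ n f → ∑< (n ℕ.* 2) f ≡ (∑[ i < n ] f (2 ℕ.* i)) + (∑[ i < n ] f (2 ℕ.* i ℕ.+ 1))
∑-evens-odds n f = begin
  ∑< (n ℕ.* 2) f
    ≡⟨ ∑-blocks n 2 f ⟩
  (∑[ i < n ] (f (i ℕ.* 2) + (f (suc (i ℕ.* 2)) + 0ℤ)))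
    ≡⟨ ∑-ext n (λ i → cong₂ _+_ (cong f (ℕ.*-comm i 2))
         (trans (ℤ.+-identityʳ (f (suc (i ℕ.* 2))))
                (cong f (trans (ℕ.+-comm 1 (i ℕ.* 2)) (cong (ℕ._+ 1) (ℕ.*-comm i 2)))))) ⟩
  (∑[ i < n ] (f (2 ℕ.* i) + f (2 ℕ.* i ℕ.+ 1)))
    ≡⟨ ∑-+ n (λ i → f (2 ℕ.* i)) (λ i → f (2 ℕ.* i ℕ.+ 1)) ⟩
  (∑[ i < n ] f (2 ℕ.* i)) + (∑[ i < n ] f (2 ℕ.* i ℕ.+ 1))  ∎

[1+m*2]/2 : ∀ m → suc (m ℕ.* 2) / 2 ≡ m
[1+m*2]/2 m = trans (+-distrib-/-∣ʳ 1 {m ℕ.* 2} {2} (ℕ.n∣m*n m)) (m*n/n≡m m 2)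

-- An even k is presented as `suc q * 2`, so that k - 1 is visibly the odd number `suc (q * 2)`.
odd⊎even : ∀ k → 1 ≤ k → ∃[ q ] (k ≡ suc (q ℕ.* 2) ⊎ k ≡ suc q ℕ.* 2)
odd⊎even k 1≤k with k % 2 | k / 2 | m≡m%n+[m/n]*n k 2 | m%n<n k 2
... | 1           | q     | k≡ | _ = q , inj₁ k≡
... | 0           | suc q | k≡ | _ = q , inj₂ k≡
... | 0           | zero  | k≡ | _ = contradiction (subst (1 ≤_) k≡ 1≤k) λ ()
... | suc (suc _) | _     | _  | s≤s (s≤s ())

-- At k = 0 the truncated `k ∸ 1` would leave a spurious term at index 1, hence the bound on k.
∑-parity : ∀ k f → 1 ≤ k →
           ∑< (suc k) f ≡ (∑[ i < suc (k / 2) ] f (2 ℕ.* i)) + (∑[ i < suc ((k ∸ 1) / 2) ] f (2 ℕ.* i ℕ.+ 1))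
∑-parity k f 1≤k with odd⊎even k 1≤k
... | q , inj₁ refl = trans (∑-evens-odds (suc q) f)
  (cong₂ (λ m n → (∑[ i < suc m ] f (2 ℕ.* i)) + (∑[ i < suc n ] f (2 ℕ.* i ℕ.+ 1)))
         (sym ([1+m*2]/2 q)) (sym (m*n/n≡m q 2)))
... | q , inj₂ refl = begin
  ∑< (suc (suc q ℕ.* 2)) f
    ≡⟨ ∑-last (suc q ℕ.* 2) f ⟩
  ∑< (suc q ℕ.* 2) f + f (suc q ℕ.* 2)
    ≡⟨ cong₂ _+_ (∑-evens-odds (suc q) f) (cong f (ℕ.*-comm (suc q) 2)) ⟩
  ∑< (suc q) evens + ∑< (suc q) odds + f (2 ℕ.* suc q)
    ≡⟨ shape (∑< (suc q) evens) (∑< (suc q) odds) (f (2 ℕ.* suc q)) ⟩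
  (∑< (suc q) evens + f (2 ℕ.* suc q)) + ∑< (suc q) odds
    ≡⟨ cong (_+ ∑< (suc q) odds) (∑-last (suc q) evens) ⟨
  ∑< (suc (suc q)) evens + ∑< (suc q) odds
    ≡⟨ cong₂ (λ m n → ∑< (suc m) evens + ∑< (suc n) odds)
         (sym (m*n/n≡m (suc q) 2)) (sym ([1+m*2]/2 q)) ⟩
  ∑< (suc (suc q ℕ.* 2 / 2)) evens + ∑< (suc (suc (q ℕ.* 2) / 2)) odds  ∎
  where
  evens odds : ℕ → ℤ
  evens i = f (2 ℕ.* i)
  odds  i = f (2 ℕ.* i ℕ.+ 1)
  shape : ∀ a b c → a + b + c ≡ (a + c) + b
  shape = solve-∀

sgn-2* : ∀ i → sgn (2 ℕ.* i) ≡ 1ℤ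
sgn-2* i = trans (sym (ℤ.^-*-assoc -1ℤ 2 i)) (ℤ.^-zeroˡ i)

sgn-2*+1 : ∀ i → sgn (2 ℕ.* i ℕ.+ 1) ≡ -1ℤ
sgn-2*+1 i = trans (ℤ.^-distribˡ-+-* -1ℤ (2 ℕ.* i) 1) (cong (_* -1ℤ) (sgn-2* i))

sumTo-∑ : ∀ m f → sumTo m f ≡ ∑< (suc m) f
sumTo-∑ m f = ∑ₗ-upTo (suc m) f

sumToWhere-∑ : ∀ m {P : ℕ → Set} (P? : ∀ i → Dec (P i)) f →
               sumToWhere m P? f ≡ (∑[ i < suc m ] (⟦ P? i ⟧ * f i))
sumToWhere-∑ m P? f = trans (∑ₗ-filter P? (upTo (suc m)) f) (∑ₗ-upTo (suc m) (λ i → ⟦ P? i ⟧ * f i))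

-- The count modulo an odd prime

module PrimeModulus (p : ℕ) (p-prime : Prime p) (h : ℕ) (p≡1+2h : p ≡ suc (h ℕ.+ h)) where

  open OddPrime p p-prime h p≡1+2h

  η : ℤ → ℤ
  η a = + p * δ p a - 1ℤ

  squareSum : (ℤ → ℤ) → ℤ → ℤ
  squareSum f a = ∑[ x < p ] f (a - + x * + x)

  -- squareSum^ m η, which the evaluations of ∑χ[a-x²] and ∑δ[a-x²] close up with period two.
  H : ℕ → ℤ → ℤ
  H 0             a = η a
  H 1             a = + p * χ a
  H (suc (suc m)) a = (ε * + p) * H m a

  squareSum-H : ∀ m a → squareSum (H m) a ≡ H (suc m) a
  squareSum-H 0 a = ∑δ[a-x²] a
  squareSum-H 1 a = begin
    (∑[ x < p ] (+ p * χ (a - + x * + x)))  ≡⟨ ∑-*ˡ p (+ p) (λ x → χ (a - + x * + x)) ⟩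
    + p * (∑[ x < p ] χ (a - + x * + x))    ≡⟨ cong (+ p *_) (∑χ[a-x²] a) ⟩
    + p * (ε * η a)                         ≡⟨ shape (+ p) ε (η a) ⟩
    (ε * + p) * η a                         ∎
    where
    shape : ∀ p e x → p * (e * x) ≡ (e * p) * x
    shape = solve-∀
  squareSum-H (suc (suc m)) a = trans (∑-*ˡ p (ε * + p) (λ x → H m (a - + x * + x)))
                                      (cong ((ε * + p) *_) (squareSum-H m a))

  -- A commutes with the powers of B because both are combinations of translations.
  squareSum-binomialShift : ∀ l f a →
    squareSum (binomialShift l f) a ≡ binomialShift l (squareSum f) a
  squareSum-binomialShift l f a = begin
    (∑[ x < p ] ∑[ j < suc l ] (+ (l C j) * f (a - + x * + x - + j)))
      ≡⟨ ∑-swap p (suc l) (λ x j → + (l C j) * f (a - + x * + x - + j)) ⟩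
    (∑[ j < suc l ] ∑[ x < p ] (+ (l C j) * f (a - + x * + x - + j)))
      ≡⟨ ∑-ext (suc l) (λ j → trans (∑-*ˡ p (+ (l C j)) (λ x → f (a - + x * + x - + j)))
           (cong (+ (l C j) *_) (∑-ext p λ x → cong f (shape a (+ x * + x) (+ j))))) ⟩
    binomialShift l (squareSum f) a  ∎
    where
    shape : ∀ a y j → a - y - j ≡ a - j - y
    shape = solve-∀

  -- Modulo a prime only the classes 0 and 1 fail to be exceptional, and they are distinct, so
  -- subtracting both indicators never overcounts.
  e-prime : ∀ a → e p a ≡ 1ℤ - δ p a - δ p (a - 1ℤ)
  e-prime a with + p ∣? a | + p ∣? a - 1ℤ
  ... | yes d | yes d′ = contradiction (∣-resp (shape a) (∣m∣n⇒∣m-n d d′)) p∤1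
    where
    shape : ∀ a → a - (a - 1ℤ) ≡ 1ℤ
    shape = solve-∀
  ... | yes d | no _   = ⟦⟧-no (exceptional? p a) λ { (u , _) → ¬unit a d u }
    where
    ¬unit : ∀ a → + p ∣ a → ¬ Unit p a
    ¬unit a d u = ¬prime[1] (subst Prime (u (ℕ.∣-refl , ∣⇒∣ᵤ d)) p-prime)
  ... | no _  | yes d  = ⟦⟧-no (exceptional? p a) λ { (_ , u) →
                           ¬prime[1] (subst Prime (u (ℕ.∣-refl , ∣⇒∣ᵤ (∣-flip a 1ℤ d))) p-prime) }
  ... | no ¬d | no ¬d′ = ⟦⟧-yes (exceptional? p a) (unit a ¬d , unit (1ℤ - a) (¬d′ ∘ ∣-flip 1ℤ a))
    where
    unit : ∀ a → ¬ + p ∣ a → Unit p a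
    unit a p∤a (d∣p , d∣a) with prime⇒irreducible p-prime d∣p
    ... | inj₁ d≡1  = d≡1
    ... | inj₂ refl = contradiction (∣ᵤ⇒∣ d∣a) p∤a

  -- The recursion as T = A - B: the excluded classes x = 0 and x = 1 account for the values at a -
  -- 0² and a - 1².
  W-suc : ∀ k a → W p (suc k) a ≡ squareSum (W p k) a - W p k a - W p k (a - 1ℤ)
  W-suc k a = begin
    (∑[ x < p ] (e p (+ x) * w (+ x)))
      ≡⟨ ∑-ext p (λ x → trans (cong (_* w (+ x)) (e-prime (+ x)))
           (expand (δ p (+ x)) (δ p (+ x - 1ℤ)) (w (+ x)))) ⟩
    (∑[ x < p ] (w (+ x) - δ p (+ x) * w (+ x) - δ p (+ x - 1ℤ) * w (+ x)))
      ≡⟨ trans (∑-- p (λ x → w (+ x) - δ p (+ x) * w (+ x)) (λ x → δ p (+ x - 1ℤ) * w (+ x)))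
           (cong (_- (∑[ x < p ] (δ p (+ x - 1ℤ) * w (+ x))))
             (∑-- p (λ x → w (+ x)) (λ x → δ p (+ x) * w (+ x)))) ⟩
    squareSum (W p k) a - (∑[ x < p ] (δ p (+ x) * w (+ x))) - (∑[ x < p ] (δ p (+ x - 1ℤ) * w (+ x)))
      ≡⟨ cong₂ (λ s t → squareSum (W p k) a - s - t)
           (trans (∑-ext p λ x → cong (λ b → δ p b * w (+ x)) (sym (ℤ.+-identityʳ (+ x))))
                  (trans (∑-sift p w-periodic 0ℤ) (cong (W p k) (ℤ.+-identityʳ a))))
           (∑-sift p w-periodic 1ℤ) ⟩
    squareSum (W p k) a - W p k a - W p k (a - 1ℤ)  ∎
    where
    w : ℤ → ℤ
    w x = W p k (a - x * x)
    w-periodic : Periodic p w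
    w-periodic x y d = W-periodic p k (a - x * x) (a - y * y) (∣-minus-square a x y d)
    expand : ∀ d d′ w → (1ℤ - d - d′) * w ≡ w - d * w - d′ * w
    expand = solve-∀

  -- (B - A)^k η, with `H m` in the place of A^m η and `binomialShift (k ∸ m)` in the place of B^(k
  -- - m).
  R : ℕ → ℤ → ℤ
  R k a = ∑[ m < suc k ] (+ (k C m) * (sgn m * binomialShift (k ∸ m) (H m) a))

  squareSum-R : ∀ k a → squareSum (R k) a
                ≡ (∑[ m < suc k ] (+ (k C m) * (sgn m * binomialShift (k ∸ m) (H (suc m)) a)))
  squareSum-R k a = begin
    (∑[ x < p ] ∑[ m < suc k ] (+ (k C m) * (sgn m * S x m)))
      ≡⟨ ∑-swap p (suc k) (λ x m → + (k C m) * (sgn m * S x m)) ⟩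
    (∑[ m < suc k ] ∑[ x < p ] (+ (k C m) * (sgn m * S x m)))
      ≡⟨ ∑-ext (suc k) (λ m → trans (∑-*ˡ p (+ (k C m)) (λ x → sgn m * S x m)) (cong (+ (k C m) *_)
           (trans (∑-*ˡ p (sgn m) (λ x → S x m)) (cong (sgn m *_)
             (trans (squareSum-binomialShift (k ∸ m) (H m) a)
                    (∑-ext (suc (k ∸ m)) λ j → cong (+ ((k ∸ m) C j) *_) (squareSum-H m (a - + j)))))))) ⟩
    (∑[ m < suc k ] (+ (k C m) * (sgn m * binomialShift (k ∸ m) (H (suc m)) a)))  ∎
    where
    S : ℕ → ℕ → ℤ
    S x m = binomialShift (k ∸ m) (H m) (a - + x * + x)

  -- Pascal's rule separates one factor B, which lengthens the shift, from one factor - A, which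
  -- raises the index of `H` and flips the sign.
  R-suc : ∀ k a → R (suc k) a ≡ R k a + R k (a - 1ℤ) - squareSum (R k) a
  R-suc k a = begin
    R (suc k) a
      ≡⟨ ∑-pascal k (λ m → sgn m * binomialShift (suc k ∸ m) (H m) a) ⟩
    (∑[ m < suc k ] (+ (k C m) * (sgn m * binomialShift (suc k ∸ m) (H m) a)))
      + (∑[ m < suc k ] (+ (k C m) * (sgn (suc m) * binomialShift (k ∸ m) (H (suc m)) a)))
      ≡⟨ cong₂ _+_
           -- `suc k ∸ m` equals `suc (k ∸ m)` only for m ≤ k, so the range of m enters here.
           (trans (∑-cong (suc k) λ m m≤k → trans
             (cong (λ s → + (k C m) * (sgn m * s)) (trans
               (cong (λ l → binomialShift l (H m) a) (ℕ.+-∸-assoc 1 (ℕ.≤-pred m≤k)))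
               (binomialShift-suc (k ∸ m) (H m) a)))
             (expand (+ (k C m)) (sgn m) (binomialShift (k ∸ m) (H m) a) (binomialShift (k ∸ m) (H m) (a - 1ℤ))))
             (∑-+ (suc k) (term a) (term (a - 1ℤ))))
           (trans (∑-ext (suc k) λ m → negate (+ (k C m)) (sgn m) (binomialShift (k ∸ m) (H (suc m)) a))
             (trans (∑-neg (suc k) (λ m → + (k C m) * (sgn m * binomialShift (k ∸ m) (H (suc m)) a)))
                    (cong -_ (sym (squareSum-R k a))))) ⟩
    R k a + R k (a - 1ℤ) - squareSum (R k) a  ∎
    where
    term : ℤ → ℕ → ℤ
    term b m = + (k C m) * (sgn m * binomialShift (k ∸ m) (H m) b)
    expand : ∀ c s x y → c * (s * (x + y)) ≡ c * (s * x) + c * (s * y)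
    expand = solve-∀
    negate : ∀ c s x → c * (((- 1ℤ) * s) * x) ≡ - (c * (s * x))
    negate = solve-∀

  -- pδ = 1 + η, and T = squareSum - id - shift acts on 1 as p - 2;
  -- R k is the binomial expansion of (- T)^k η.
  W≡R : ∀ k a → sgn k * (+ p * W p k a) ≡ (+ 2 - + p) ℤ.^ k + R k a
  W≡R zero a = trans (expand (+ p * δ p a))
    (cong (λ b → 1ℤ + (1ℤ * (1ℤ * (1ℤ * η b + 0ℤ)) + 0ℤ)) (sym (ℤ.+-identityʳ a)))
    where
    expand : ∀ x → 1ℤ * x ≡ 1ℤ + (1ℤ * (1ℤ * (1ℤ * (x - 1ℤ) + 0ℤ)) + 0ℤ)
    expand = solve-∀
  W≡R (suc k) a = begin
    sgn (suc k) * (+ p * W p (suc k) a)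
      ≡⟨ cong (λ w → sgn (suc k) * (+ p * w)) (W-suc k a) ⟩
    sgn (suc k) * (+ p * (squareSum (W p k) a - W p k a - W p k (a - 1ℤ)))
      ≡⟨ distribute (sgn k) (+ p) (squareSum (W p k) a) (W p k a) (W p k (a - 1ℤ)) ⟩
    F a + F (a - 1ℤ) - sgn k * (+ p * squareSum (W p k) a)
      ≡⟨ cong (λ s → F a + F (a - 1ℤ) - s) (trans
           (sym (trans (∑-*ˡ p (sgn k) (λ x → + p * W p k (a - + x * + x)))
                       (cong (sgn k *_) (∑-*ˡ p (+ p) (λ x → W p k (a - + x * + x))))))
           (trans (∑-ext p λ x → W≡R k (a - + x * + x))
                  (trans (∑-+ p (λ _ → b) (λ x → R k (a - + x * + x)))
                         (cong (_+ squareSum (R k) a) (∑-const p b))))) ⟩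
    F a + F (a - 1ℤ) - (+ p * b + squareSum (R k) a)
      ≡⟨ cong₂ (λ s t → s + t - (+ p * b + squareSum (R k) a)) (W≡R k a) (W≡R k (a - 1ℤ)) ⟩
    (b + R k a) + (b + R k (a - 1ℤ)) - (+ p * b + squareSum (R k) a)
      ≡⟨ collect b (+ p) (R k a) (R k (a - 1ℤ)) (squareSum (R k) a) ⟩
    (+ 2 - + p) * b + (R k a + R k (a - 1ℤ) - squareSum (R k) a)
      ≡⟨ cong (_+_ ((+ 2 - + p) * b)) (R-suc k a) ⟨
    (+ 2 - + p) * b + R (suc k) a  ∎
    where
    b = (+ 2 - + p) ℤ.^ k
    F : ℤ → ℤ
    F a = sgn k * (+ p * W p k a)
    distribute : ∀ s p x y z → ((- 1ℤ) * s) * (p * (x - y - z)) ≡ s * (p * y) + s * (p * z) - s * (p * x)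
    distribute = solve-∀
    collect : ∀ b p x y z → (b + x) + (b + y) - (p * b + z) ≡ (+ 2 - p) * b + (x + y - z)
    collect = solve-∀

  half : ∀ i → ((p ∸ 1) ℕ.* i) / 2 ≡ h ℕ.* i
  half i = trans (cong (_/ 2) (trans (cong (λ q → (q ∸ 1) ℕ.* i) p≡1+2h)
    (trans (ℕ.*-distribʳ-+ i h h) (trans (cong (λ m → h ℕ.* i ℕ.+ m) (sym (ℕ.+-identityʳ (h ℕ.* i))))
      (ℕ.*-comm 2 (h ℕ.* i)))))) (m*n/n≡m (h ℕ.* i) 2)

  ε^[1+i] : ∀ i → sgn (h ℕ.* suc i) ≡ ε * sgn (h ℕ.* i)
  ε^[1+i] i = trans (cong sgn (ℕ.*-suc h i)) (ℤ.^-distribˡ-+-* -1ℤ h (h ℕ.* i))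

  -- `sgn (h * i) * p ^ i` is (ε p)^i as the formula spells it, with ε^i merged into a single
  -- exponent.
  H-step : ∀ i → (ε * + p) * (sgn (h ℕ.* i) * + (p ℕ.^ i)) ≡ sgn (h ℕ.* suc i) * + (p ℕ.^ suc i)
  H-step i = trans (shape ε (+ p) (sgn (h ℕ.* i)) (+ (p ℕ.^ i)))
    (cong₂ _*_ (sym (ε^[1+i] i)) (sym (ℤ.pos-* p (p ℕ.^ i))))
    where
    shape : ∀ e p s q → (e * p) * (s * q) ≡ (e * s) * (p * q)
    shape = solve-∀

  H-even : ∀ i a → H (2 ℕ.* i) a ≡ (sgn (h ℕ.* i) * + (p ℕ.^ i)) * η a
  H-even zero    a = trans (sym (ℤ.*-identityˡ (η a))) (cong (λ m → (sgn m * 1ℤ) * η a) (sym (ℕ.*-zeroʳ h)))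
  H-even (suc i) a = begin
    H (2 ℕ.* suc i) a                                           ≡⟨ cong (λ m → H m a) (ℕ.*-suc 2 i) ⟩
    (ε * + p) * H (2 ℕ.* i) a                                   ≡⟨ cong ((ε * + p) *_) (H-even i a) ⟩
    (ε * + p) * ((sgn (h ℕ.* i) * + (p ℕ.^ i)) * η a)           ≡⟨ ℤ.*-assoc (ε * + p) (sgn (h ℕ.* i) * + (p ℕ.^ i)) (η a) ⟨
    ((ε * + p) * (sgn (h ℕ.* i) * + (p ℕ.^ i))) * η a           ≡⟨ cong (_* η a) (H-step i) ⟩
    (sgn (h ℕ.* suc i) * + (p ℕ.^ suc i)) * η a                 ∎

  H-odd : ∀ i a → H (2 ℕ.* i ℕ.+ 1) a ≡ (sgn (h ℕ.* i) * + (p ℕ.^ i)) * (+ p * χ a)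
  H-odd zero    a = trans (sym (ℤ.*-identityˡ (+ p * χ a)))
                          (cong (λ m → (sgn m * 1ℤ) * (+ p * χ a)) (sym (ℕ.*-zeroʳ h)))
  H-odd (suc i) a = begin
    H (2 ℕ.* suc i ℕ.+ 1) a
      ≡⟨ cong (λ m → H (m ℕ.+ 1) a) (ℕ.*-suc 2 i) ⟩
    (ε * + p) * H (2 ℕ.* i ℕ.+ 1) a
      ≡⟨ cong ((ε * + p) *_) (H-odd i a) ⟩
    (ε * + p) * ((sgn (h ℕ.* i) * + (p ℕ.^ i)) * (+ p * χ a))
      ≡⟨ ℤ.*-assoc (ε * + p) (sgn (h ℕ.* i) * + (p ℕ.^ i)) (+ p * χ a) ⟨
    ((ε * + p) * (sgn (h ℕ.* i) * + (p ℕ.^ i))) * (+ p * χ a)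
      ≡⟨ cong (_* (+ p * χ a)) (H-step i) ⟩
    (sgn (h ℕ.* suc i) * + (p ℕ.^ suc i)) * (+ p * χ a)  ∎

  binomialShift-* : ∀ l {f} g c a → (∀ b → f b ≡ c * g b) → binomialShift l f a ≡ c * binomialShift l g a
  binomialShift-* l g c a f≡cg = trans
    (∑-ext (suc l) λ j → trans (cong (+ (l C j) *_) (f≡cg (a - + j))) (shape (+ (l C j)) c (g (a - + j))))
    (∑-*ˡ (suc l) c (λ j → + (l C j) * g (a - + j)))
    where
    shape : ∀ b c x → b * (c * x) ≡ c * (b * x)
    shape = solve-∀

  module _ (k : ℕ) (c : ℤ) where

    -- This and `oddTerm` repeat the summands of `bracket` verbatim, so that the last step of
    -- `W-prime` ends in it by definition.
    evenTerm : ℕ → ℤ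
    evenTerm i =
      sgn (((p ∸ 1) ℕ.* i) / 2) * + (p ℕ.^ i) * + (k C (2 ℕ.* i))
      * (+ (2 ℕ.^ (k ∸ 2 ℕ.* i))
         - + p * sumToWhere (k ∸ 2 ℕ.* i) (pdiv? p c) (λ j → + ((k ∸ 2 ℕ.* i) C j)))

    oddTerm : ℕ → ℤ
    oddTerm i =
      sgn (((p ∸ 1) ℕ.* (i ℕ.+ 1)) / 2) * + (p ℕ.^ (i ℕ.+ 1)) * + (k C (2 ℕ.* i ℕ.+ 1))
      * sumToWhere (k ∸ 2 ℕ.* i ∸ 1) (λ j → ¬? (pdiv? p c j))
          (λ j → + ((k ∸ 2 ℕ.* i ∸ 1) C j) * legendre (+ j - c) p)

    -- The constant - 1 in η sums to - 2^l, and pδ selects the j congruent to c.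
    binomialShift-η : ∀ l → binomialShift l η c
                      ≡ - (+ (2 ℕ.^ l) - + p * sumToWhere l (pdiv? p c) (λ j → + (l C j)))
    binomialShift-η l = begin
      (∑[ j < suc l ] (+ (l C j) * (+ p * δ p (c - + j) - 1ℤ)))
        ≡⟨ ∑-ext (suc l) (λ j → trans
             (cong (λ d → + (l C j) * (+ p * d - 1ℤ))
               (⟦⟧-cong (+ p ∣? c - + j) (pdiv? p c j)
                 (λ d → ∣⇒∣ᵤ (∣-flip c (+ j) d)) (λ d → ∣-flip (+ j) c (∣ᵤ⇒∣ d))))
             (shape (+ (l C j)) (+ p) ⟦ pdiv? p c j ⟧)) ⟩
      (∑[ j < suc l ] (+ p * (⟦ pdiv? p c j ⟧ * + (l C j)) - + (l C j) * 1ℤ))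
        ≡⟨ ∑-- (suc l) (λ j → + p * (⟦ pdiv? p c j ⟧ * + (l C j))) (λ j → + (l C j) * 1ℤ) ⟩
      (∑[ j < suc l ] (+ p * (⟦ pdiv? p c j ⟧ * + (l C j)))) - (∑[ j < suc l ] (+ (l C j) * 1ℤ))
        ≡⟨ cong₂ _-_ (trans (∑-*ˡ (suc l) (+ p) (λ j → ⟦ pdiv? p c j ⟧ * + (l C j)))
             (cong (+ p *_) (sym (sumToWhere-∑ l (pdiv? p c) (λ j → + (l C j))))))
             (∑-binomial l) ⟩
      + p * sumToWhere l (pdiv? p c) (λ j → + (l C j)) - + (2 ℕ.^ l)
        ≡⟨ flip (+ p * sumToWhere l (pdiv? p c) (λ j → + (l C j))) (+ (2 ℕ.^ l)) ⟩
      - (+ (2 ℕ.^ l) - + p * sumToWhere l (pdiv? p c) (λ j → + (l C j)))  ∎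
      where
      shape : ∀ b p d → b * (p * d - 1ℤ) ≡ p * (d * b) - b * 1ℤ
      shape = solve-∀
      flip : ∀ x y → x - y ≡ - (y - x)
      flip = solve-∀

    -- The translations produce χ(c - j) where the formula has χ(j - c). The resulting ε is what
    -- turns i into i + 1 in the exponent of - 1.
    binomialShift-χ : ∀ l → binomialShift l χ c
                      ≡ ε * sumToWhere l (λ j → ¬? (pdiv? p c j)) (λ j → + (l C j) * legendre (+ j - c) p)
    binomialShift-χ l = begin
      (∑[ j < suc l ] (+ (l C j) * χ (c - + j)))
        ≡⟨ ∑-ext (suc l) (λ j → trans
             (cong (+ (l C j) *_) (trans (cong χ (flip c (+ j)))
               (trans (χ-neg (+ j - c)) (cong (_* χ (+ j - c)) χ[-1]))))
             (trans (shape (+ (l C j)) ε (χ (+ j - c))) (cong (ε *_) (restrict j)))) ⟩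
      (∑[ j < suc l ] (ε * (⟦ ¬? (pdiv? p c j) ⟧ * (+ (l C j) * χ (+ j - c)))))
        ≡⟨ ∑-*ˡ (suc l) ε (λ j → ⟦ ¬? (pdiv? p c j) ⟧ * (+ (l C j) * χ (+ j - c))) ⟩
      ε * (∑[ j < suc l ] (⟦ ¬? (pdiv? p c j) ⟧ * (+ (l C j) * χ (+ j - c))))
        ≡⟨ cong (ε *_) (sumToWhere-∑ l (λ j → ¬? (pdiv? p c j)) (λ j → + (l C j) * χ (+ j - c))) ⟨
      ε * sumToWhere l (λ j → ¬? (pdiv? p c j)) (λ j → + (l C j) * legendre (+ j - c) p)  ∎
      where
      flip : ∀ x y → x - y ≡ - (y - x)
      flip = solve-∀
      shape : ∀ b e x → b * (e * x) ≡ e * (b * x)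
      shape = solve-∀
      -- The indices with p ∣ j - c may be dropped because χ vanishes there.
      restrict : ∀ j → + (l C j) * χ (+ j - c) ≡ ⟦ ¬? (pdiv? p c j) ⟧ * (+ (l C j) * χ (+ j - c))
      restrict j = go (pdiv? p c j)
        where
        go : ∀ (d? : Dec (p ℕ.∣ ∣ + j - c ∣)) →
             + (l C j) * χ (+ j - c) ≡ ⟦ ¬? d? ⟧ * (+ (l C j) * χ (+ j - c))
        go (yes d) = trans (cong (+ (l C j) *_) (χ≡0 (+ j - c) (∣ᵤ⇒∣ d))) (ℤ.*-zeroʳ (+ (l C j)))
        go (no _)  = sym (ℤ.*-identityˡ _)

    R-even : ∀ i → + (k C (2 ℕ.* i)) * (sgn (2 ℕ.* i) * binomialShift (k ∸ 2 ℕ.* i) (H (2 ℕ.* i)) c)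
                   ≡ - evenTerm i
    R-even i = begin
      + (k C (2 ℕ.* i)) * (sgn (2 ℕ.* i) * binomialShift (k ∸ 2 ℕ.* i) (H (2 ℕ.* i)) c)
        ≡⟨ cong₂ (λ s t → + (k C (2 ℕ.* i)) * (s * t)) (sgn-2* i)
             (trans (binomialShift-* (k ∸ 2 ℕ.* i) η (sgn (h ℕ.* i) * + (p ℕ.^ i)) c (H-even i))
                    (cong ((sgn (h ℕ.* i) * + (p ℕ.^ i)) *_) (binomialShift-η (k ∸ 2 ℕ.* i)))) ⟩
      + (k C (2 ℕ.* i)) * (1ℤ * ((sgn (h ℕ.* i) * + (p ℕ.^ i)) * - B))
        ≡⟨ shape (+ (k C (2 ℕ.* i))) (sgn (h ℕ.* i)) (+ (p ℕ.^ i)) B ⟩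
      - (sgn (h ℕ.* i) * + (p ℕ.^ i) * + (k C (2 ℕ.* i)) * B)
        ≡⟨ cong (λ m → - (sgn m * + (p ℕ.^ i) * + (k C (2 ℕ.* i)) * B)) (half i) ⟨
      - evenTerm i  ∎
      where
      B = + (2 ℕ.^ (k ∸ 2 ℕ.* i)) - + p * sumToWhere (k ∸ 2 ℕ.* i) (pdiv? p c) (λ j → + ((k ∸ 2 ℕ.* i) C j))
      shape : ∀ b s q x → b * (1ℤ * ((s * q) * - x)) ≡ - (s * q * b * x)
      shape = solve-∀

    R-odd : ∀ i → + (k C (2 ℕ.* i ℕ.+ 1))
                  * (sgn (2 ℕ.* i ℕ.+ 1) * binomialShift (k ∸ (2 ℕ.* i ℕ.+ 1)) (H (2 ℕ.* i ℕ.+ 1)) c)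
                  ≡ - oddTerm i
    R-odd i = begin
      + (k C m) * (sgn m * binomialShift (k ∸ m) (H m) c)
        ≡⟨ cong₂ (λ s t → + (k C m) * (s * t)) (sgn-2*+1 i)
             (trans (cong (λ l → binomialShift l (H m) c) (sym (ℕ.∸-+-assoc k (2 ℕ.* i) 1)))
             (trans (binomialShift-* l χ ((sgn (h ℕ.* i) * + (p ℕ.^ i)) * + p) c
                      (λ b → trans (H-odd i b) (sym (ℤ.*-assoc (sgn (h ℕ.* i) * + (p ℕ.^ i)) (+ p) (χ b)))))
                    (cong (((sgn (h ℕ.* i) * + (p ℕ.^ i)) * + p) *_) (binomialShift-χ l)))) ⟩
      + (k C m) * (-1ℤ * (((sgn (h ℕ.* i) * + (p ℕ.^ i)) * + p) * (ε * B)))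
        ≡⟨ shape (+ (k C m)) (sgn (h ℕ.* i)) (+ (p ℕ.^ i)) (+ p) ε B ⟩
      - ((ε * sgn (h ℕ.* i)) * (+ p * + (p ℕ.^ i)) * + (k C m) * B)
        ≡⟨ cong₂ (λ s q → - (s * q * + (k C m) * B)) (ε^[1+i] i) (ℤ.pos-* p (p ℕ.^ i)) ⟨
      - (sgn (h ℕ.* suc i) * + (p ℕ.^ suc i) * + (k C m) * B)
        ≡⟨ cong₂ (λ s q → - (sgn s * + (p ℕ.^ q) * + (k C m) * B))
             (trans (half (i ℕ.+ 1)) (cong (h ℕ.*_) (ℕ.+-comm i 1))) (ℕ.+-comm i 1) ⟨
      - oddTerm i  ∎
      where
      m = 2 ℕ.* i ℕ.+ 1
      l = k ∸ 2 ℕ.* i ∸ 1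
      B = sumToWhere l (λ j → ¬? (pdiv? p c j)) (λ j → + (l C j) * legendre (+ j - c) p)
      shape : ∀ b s q p e x → b * ((- 1ℤ) * (((s * q) * p) * (e * x))) ≡ - ((e * s) * (p * q) * b * x)
      shape = solve-∀

    -- Both sums enter with a minus sign, for different reasons: the even one from
    -- `binomialShift-η`, the odd one from the sign of (- A)^(2i+1).
    W-prime : 1 ≤ k → sgn k * (+ p * W p k c) ≡ bracket k c p
    W-prime 1≤k = begin
      sgn k * (+ p * W p k c)
        ≡⟨ W≡R k c ⟩
      b + R k c
        ≡⟨ cong (_+_ b) (trans (∑-parity k (λ m → + (k C m) * (sgn m * binomialShift (k ∸ m) (H m) c)) 1≤k) (cong₂ _+_
             (trans (∑-ext (suc (k / 2)) R-even)
               (trans (∑-neg (suc (k / 2)) evenTerm) (cong -_ (sym (sumTo-∑ (k / 2) evenTerm)))))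
             (trans (∑-ext (suc ((k ∸ 1) / 2)) R-odd)
               (trans (∑-neg (suc ((k ∸ 1) / 2)) oddTerm) (cong -_ (sym (sumTo-∑ ((k ∸ 1) / 2) oddTerm))))))) ⟩
      b + (- sumTo (k / 2) evenTerm + - sumTo ((k ∸ 1) / 2) oddTerm)
        ≡⟨ ℤ.+-assoc b (- sumTo (k / 2) evenTerm) (- sumTo ((k ∸ 1) / 2) oddTerm) ⟨
      bracket k c p  ∎
      where
      b = (+ 2 - + p) ℤ.^ k

  -- Hensel lifting

  -- As p ∣ n, the moduli p n and n have the same prime divisors.
  e-lift : ∀ n a → p ℕ.∣ n → e (p ℕ.* n) a ≡ e n a
  e-lift n a p∣n = ⟦⟧-cong (exceptional? (p ℕ.* n) a) (exceptional? n a)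
    (exceptional-∣ a (ℕ.n∣m*n p)) (λ x → exceptional-* a (exceptional-∣ a p∣n x) x)

  -- A solution modulo p n is one modulo n, so a - y² = q n may be assumed. Division by n then
  -- leaves q - 2 y z ≡ 0 modulo p, which has one root z because p divides neither 2 nor y.
  δ-lift : ∀ n .{{_ : NonZero n}} a y → p ℕ.∣ n → Unit n y →
           (∑[ z < p ] δ (p ℕ.* n) (a - (y + + n * + z) * (y + + n * + z))) ≡ δ n (a - y * y)
  δ-lift n a y p∣n@(ℕ.divides m n≡m*p) unit with + n ∣? a - y * y
  ... | no n∤ = trans (∑-ext p λ z → ⟦⟧-no (+ (p ℕ.* n) ∣? a - (y + + n * + z) * (y + + n * + z)) λ d →
          n∤ (∣-resp (shape a y (+ n) (+ z)) (∣m∣n⇒∣m+n (∣-trans (∣ᵤ⇒∣ (ℕ.n∣m*n p)) d)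
                (∣m⇒∣m*n (+ 2 * y * + z + + n * + z * + z) ∣-refl))))
          (∑-zero p)
    where
    shape : ∀ a y n z → a - (y + n * z) * (y + n * z) + n * (+ 2 * y * z + n * z * z) ≡ a - y * y
    shape = solve-∀
  ... | yes (divides q a-y²≡qn) = trans
          (∑-ext p λ z → ⟦⟧-cong (+ (p ℕ.* n) ∣? a - (y + + n * + z) * (y + + n * + z)) (+ p ∣? q + s * + z)
            (λ d → *-cancelʳ-∣ (+ n) (∣-resp (reduce (+ z)) (∣m∣n⇒∣m+n (cast d) (error (+ z)))))
            (λ d → uncast (∣-resp (unreduce (+ z)) (∣m∣n⇒∣m-n (*-monoˡ-∣ (+ n) d) (error (+ z))))))
          (∑δ-affine p (proj₁ s-inv) s q (proj₂ s-inv))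
    where
    s = - (+ 2 * y)
    p∤y : ¬ + p ∣ y
    p∤y d = ¬prime[1] (subst Prime (unit (p∣n , ∣⇒∣ᵤ d)) p-prime)
    p∤s : ¬ + p ∣ s
    p∤s d with euclid (+ 2) y (∣-resp (ℤ.neg-involutive (+ 2 * y)) (∣m⇒∣-m d))
    ... | inj₁ p∣2 = p∤2 p∣2
    ... | inj₂ p∣y = p∤y p∣y
    s-inv = inverse s p∤s
    -- The quadratic term of (y + n z)²: p ∣ n makes n² a multiple of p n.
    error : ∀ z → + p * + n ∣ + n * + n * z * z
    error z = divides (+ m * z * z) (begin
      + n * + n * z * z             ≡⟨ cong (λ t → t * + n * z * z) (trans (cong (λ t → + t) n≡m*p) (ℤ.pos-* m p)) ⟩
      (+ m * + p) * + n * z * z     ≡⟨ shape (+ m) (+ p) (+ n) z ⟩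
      + m * z * z * (+ p * + n)     ∎)
      where
      shape : ∀ m p n z → (m * p) * n * z * z ≡ m * z * z * (p * n)
      shape = solve-∀
    cast : ∀ {b} → + (p ℕ.* n) ∣ b → + p * + n ∣ b
    cast {b} = subst (_∣ b) (ℤ.pos-* p n)
    uncast : ∀ {b} → + p * + n ∣ b → + (p ℕ.* n) ∣ b
    uncast {b} = subst (_∣ b) (sym (ℤ.pos-* p n))
    expand : ∀ a y n z q → (a - y * y) - q * n + (q + - (+ 2 * y) * z) * n
                           ≡ a - (y + n * z) * (y + n * z) + n * n * z * z
    expand = solve-∀
    reduce : ∀ z → a - (y + + n * z) * (y + + n * z) + + n * + n * z * z ≡ (q + s * z) * + n
    reduce z = trans (sym (expand a y (+ n) z q))
      (trans (cong (_+ (q + s * z) * + n) (ℤ.i≡j⇒i-j≡0 a-y²≡qn)) (ℤ.+-identityˡ ((q + s * z) * + n)))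
    unreduce : ∀ z → (q + s * z) * + n - + n * + n * z * z ≡ a - (y + + n * z) * (y + + n * z)
    unreduce z = trans (cong (_- + n * + n * z * z) (sym (reduce z))) (cancel _ (+ n * + n * z * z))
      where
      cancel : ∀ x y → x + y - y ≡ x
      cancel = solve-∀

  -- Of the `suc k` coordinates the last is lifted uniquely by `δ-lift`, and each of the other k
  -- lifts freely in p ways, whence p^k.
  W-lift : ∀ n .{{_ : NonZero n}} k a → p ℕ.∣ n →
           W (p ℕ.* n) (suc k) a ≡ + (p ℕ.^ k) * W n (suc k) a
  W-lift n k a p∣n = begin
    (∑[ x < p ℕ.* n ] (e (p ℕ.* n) (+ x) * W (p ℕ.* n) k (a - + x * + x)))
      ≡⟨ ∑-blocks p n (λ x → e (p ℕ.* n) (+ x) * W (p ℕ.* n) k (a - + x * + x)) ⟩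
    (∑[ z < p ] ∑[ y < n ] (e (p ℕ.* n) (+ (y ℕ.+ z ℕ.* n)) * W (p ℕ.* n) k (a - + (y ℕ.+ z ℕ.* n) * + (y ℕ.+ z ℕ.* n))))
      ≡⟨ ∑-ext p (λ z → ∑-ext n λ y → cong₂ _*_
           (trans (e-lift n (+ (y ℕ.+ z ℕ.* n)) p∣n)
                  (e-periodic n (+ (y ℕ.+ z ℕ.* n)) (+ y) (∣-resp (multiple y z) (∣m⇒∣m*n (+ z) ∣-refl))))
           (cong (λ x → W (p ℕ.* n) k (a - x * x)) (coordinates y z))) ⟩
    (∑[ z < p ] ∑[ y < n ] (e n (+ y) * W (p ℕ.* n) k (a - x y z * x y z)))
      ≡⟨ ∑-swap p n (λ z y → e n (+ y) * W (p ℕ.* n) k (a - x y z * x y z)) ⟩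
    (∑[ y < n ] ∑[ z < p ] (e n (+ y) * W (p ℕ.* n) k (a - x y z * x y z)))
      ≡⟨ ∑-ext n (λ y → ∑-*ˡ p (e n (+ y)) (λ z → W (p ℕ.* n) k (a - x y z * x y z))) ⟩
    (∑[ y < n ] (e n (+ y) * (∑[ z < p ] W (p ℕ.* n) k (a - x y z * x y z))))
      ≡⟨ ∑-ext n (λ y → fibre k y) ⟩
    (∑[ y < n ] (+ (p ℕ.^ k) * (e n (+ y) * W n k (a - + y * + y))))
      ≡⟨ ∑-*ˡ n (+ (p ℕ.^ k)) (λ y → e n (+ y) * W n k (a - + y * + y)) ⟩
    + (p ℕ.^ k) * W n (suc k) a  ∎
    where
    x : ℕ → ℕ → ℤ
    x y z = + y + + n * + z
    coordinates : ∀ y z → + (y ℕ.+ z ℕ.* n) ≡ x y z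
    coordinates y z = cong (_+_ (+ y)) (trans (ℤ.pos-* z n) (ℤ.*-comm (+ z) (+ n)))
    difference : ∀ y s → s ≡ y + s - y
    difference = solve-∀
    multiple : ∀ y z → + n * + z ≡ + (y ℕ.+ z ℕ.* n) - + y
    multiple y z = trans (difference (+ y) (+ n * + z)) (cong (_- + y) (sym (coordinates y z)))
    fibre : ∀ k y → e n (+ y) * (∑[ z < p ] W (p ℕ.* n) k (a - x y z * x y z))
                    ≡ + (p ℕ.^ k) * (e n (+ y) * W n k (a - + y * + y))
    -- `δ-lift` asks for y to be a unit, which is known exactly where the weight is nonzero.
    fibre zero y with exceptional? n (+ y)
    ... | yes (unit , _) = trans (cong (1ℤ *_) (δ-lift n a (+ y) p∣n unit))
                                 (sym (ℤ.*-identityˡ (1ℤ * δ n (a - + y * + y))))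
    ... | no _  = refl
    fibre (suc k) y = trans (cong (e n (+ y) *_) (trans
        (∑-ext p λ z → trans (W-lift n k (a - x y z * x y z) p∣n)
          (cong (+ (p ℕ.^ k) *_) (W-periodic n (suc k) (a - x y z * x y z) (a - + y * + y)
            (∣-minus-square a (x y z) (+ y) (∣-resp (difference (+ y) (+ n * + z)) (∣m⇒∣m*n (+ z) ∣-refl))))))
        (∑-const p (+ (p ℕ.^ k) * W n (suc k) (a - + y * + y)))))
      (trans (shape (e n (+ y)) (+ p) (+ (p ℕ.^ k)) (W n (suc k) (a - + y * + y)))
             (cong (_* (e n (+ y) * W n (suc k) (a - + y * + y))) (sym (ℤ.pos-* p (p ℕ.^ k)))))
      where
      shape : ∀ e p q w → e * (p * (q * w)) ≡ (p * q) * (e * w)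
      shape = solve-∀

-- Valuations along a prime factorisation

-- Gives a ≤ q^a, so the fuel n of `ν` covers every exponent occurring in n.
m≤n^m : ∀ m n → 1 < n → m ≤ n ℕ.^ m
m≤n^m m n 1<n = ℕ.<⇒≤ (go m)
  where
  instance
    n≢0 : NonZero n
    n≢0 = ℕ.>-nonZero (ℕ.<-trans (s≤s z≤n) 1<n)
  go : ∀ m → m < n ℕ.^ m
  go zero    = s≤s z≤n
  go (suc m) = ℕ.≤-<-trans (go m)
    (subst (n ℕ.^ m <_) (ℕ.*-comm (n ℕ.^ m) n) (ℕ.m<m*n (n ℕ.^ m) n {{ℕ.m^n≢0 n m}} 1<n))

ν-fuel-unique : ∀ f q .{{_ : NonZero q}} a m → ¬ q ℕ.∣ m → a ≤ f → ν-fuel f q (q ℕ.^ a ℕ.* m) ≡ a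
ν-fuel-unique zero    q zero    m q∤m _ = refl
ν-fuel-unique (suc f) q a m q∤m a≤f with q ℕ.∣? (q ℕ.^ a ℕ.* m)
ν-fuel-unique (suc f) q zero m q∤m _ | yes q∣m = contradiction (subst (q ℕ.∣_) (ℕ.*-identityˡ m) q∣m) q∤m
ν-fuel-unique (suc f) q (suc a) m q∤m (s≤s a≤f) | yes (ℕ.divides r q^am≡rq) =
  cong suc (trans (cong (ν-fuel f q) r≡q^am) (ν-fuel-unique f q a m q∤m a≤f))
  where
  r≡q^am : r ≡ q ℕ.^ a ℕ.* m
  r≡q^am = ℕ.*-cancelˡ-≡ r (q ℕ.^ a ℕ.* m) q
    (trans (ℕ.*-comm q r) (trans (sym q^am≡rq) (ℕ.*-assoc q (q ℕ.^ a) m)))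
ν-fuel-unique (suc f) q zero m q∤m _ | no _ = refl
ν-fuel-unique (suc f) q (suc a) m q∤m _ | no q∤ =
  contradiction (subst (q ℕ.∣_) (sym (ℕ.*-assoc q (q ℕ.^ a) m)) (ℕ.m∣m*n (q ℕ.^ a ℕ.* m))) q∤

-- A certificate for `ν`: it can be carried along multiplication by a prime, whereas the fuelled
-- recursion does not reduce on products.
record Valuation (q n : ℕ) : Set where
  constructor valuation
  field
    exponent cofactor : ℕ
    factors           : n ≡ q ℕ.^ exponent ℕ.* cofactor
    maximal           : ¬ q ℕ.∣ cofactor

ν≡exponent : ∀ {q n} → Prime q → (v : Valuation q n) → ν q n ≡ Valuation.exponent v
ν≡exponent {q} q-prime (valuation a zero refl q∤m) = contradiction (q ℕ.∣0) q∤m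
ν≡exponent {q} q-prime (valuation a m@(suc _) refl q∤m) = ν-fuel-unique (q ℕ.^ a ℕ.* m) q a m q∤m
  (ℕ.≤-trans (m≤n^m a q (ℕ.nonTrivial⇒n>1 q)) (ℕ.m≤m*n (q ℕ.^ a) m))
  where
  instance
    q-nonZero = prime⇒nonZero q-prime
    q-nonTrivial = prime⇒nonTrivial q-prime

valuation-one : ∀ {q} → Prime q → Valuation q 1
valuation-one q-prime = valuation 0 1 refl (λ q∣1 → ¬prime[1] (subst Prime (ℕ.∣1⇒≡1 q∣1) q-prime))

valuation-same : ∀ {q n} → Valuation q n → Valuation q (q ℕ.* n)
valuation-same {q} (valuation a m n≡q^am q∤m) =
  valuation (suc a) m (trans (cong (q ℕ.*_) n≡q^am) (sym (ℕ.*-assoc q (q ℕ.^ a) m))) q∤m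

prime∣prime⇒≡ : ∀ {q p} → Prime q → Prime p → q ℕ.∣ p → q ≡ p
prime∣prime⇒≡ q-prime p-prime q∣p with prime⇒irreducible p-prime q∣p
... | inj₁ refl = contradiction q-prime ¬prime[1]
... | inj₂ q≡p  = q≡p

valuation-other : ∀ {q p n} → Prime q → Prime p → q ≢ p → Valuation q n → Valuation q (p ℕ.* n)
valuation-other {q} {p} q-prime p-prime q≢p (valuation a m n≡q^am q∤m) = valuation a (p ℕ.* m)
  (trans (trans (cong (p ℕ.*_) n≡q^am) (sym (ℕ.*-assoc p (q ℕ.^ a) m)))
    (trans (cong (ℕ._* m) (ℕ.*-comm p (q ℕ.^ a))) (ℕ.*-assoc (q ℕ.^ a) p m)))
  λ q∣pm → Data.Sum.[ (λ q∣p → q≢p (prime∣prime⇒≡ q-prime p-prime q∣p)) , q∤m ]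
    (euclidsLemma p m q-prime q∣pm)

valuation-product : ∀ {q} → Prime q → ∀ {ps} → All.All Prime ps → Valuation q (product ps)
valuation-product q-prime All.[] = valuation-one q-prime
valuation-product {q} q-prime {p ∷ ps} (p-prime All.∷ ps-prime) with q ℕ.≟ p
... | yes refl = valuation-same (valuation-product q-prime ps-prime)
... | no q≢p   = valuation-other q-prime p-prime q≢p (valuation-product q-prime ps-prime)

exponent>0 : ∀ {q n} → q ℕ.∣ n → (v : Valuation q n) → ∃[ a ] Valuation.exponent v ≡ suc a
exponent>0 q∣n (valuation zero    m refl q∤m) = contradiction (subst (_ ℕ.∣_) (ℕ.*-identityˡ m) q∣n) q∤m
exponent>0 q∣n (valuation (suc a) m _    _)   = a , refl

exponent≡0 : ∀ {q n} → ¬ q ℕ.∣ n → (v : Valuation q n) → Valuation.exponent v ≡ 0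
exponent≡0 q∤n (valuation zero    m _    _) = refl
exponent≡0 {q} q∤n (valuation (suc a) m refl _) =
  contradiction (subst (q ℕ.∣_) (sym (ℕ.*-assoc q (q ℕ.^ a) m)) (ℕ.m∣m*n (q ℕ.^ a ℕ.* m))) q∤n

-- Products over the prime divisors

∏ₗ : List ℕ → (ℕ → ℤ) → ℤ
∏ₗ xs f = foldr (λ x s → f x * s) 1ℤ xs

-- Products over prime divisors are moved to a fixed range, with 1 at all other indices, so that the
-- range stays the same when n gains a prime factor.
∏< : ℕ → (ℕ → ℤ) → ℤ
∏< zero    f = 1ℤ
∏< (suc n) f = f 0 * ∏< n (f ∘ suc)

∏-cong : ∀ n {f g} → (∀ i → i < n → f i ≡ g i) → ∏< n f ≡ ∏< n g
∏-cong zero    f≗g = refl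
∏-cong (suc n) f≗g = cong₂ _*_ (f≗g 0 (s≤s z≤n)) (∏-cong n λ i i<n → f≗g (suc i) (s≤s i<n))

∏-one : ∀ n f → (∀ i → f i ≡ 1ℤ) → ∏< n f ≡ 1ℤ
∏-one zero    f f≡1 = refl
∏-one (suc n) f f≡1 = cong₂ _*_ (f≡1 0) (∏-one n (f ∘ suc) (f≡1 ∘ suc))

∏-scale : ∀ n {f g} r c → r < n → f r ≡ c * g r → (∀ i → i ≢ r → f i ≡ g i) → ∏< n f ≡ c * ∏< n g
∏-scale (suc n) {f} {g} zero    c _         fr f≗g =
  trans (cong₂ _*_ fr (∏-cong n λ i _ → f≗g (suc i) λ ())) (ℤ.*-assoc c (g 0) (∏< n (g ∘ suc)))
∏-scale (suc n) {f} {g} (suc r) c (s≤s r<n) fr f≗g =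
  trans (cong₂ _*_ (f≗g 0 λ ()) (∏-scale n r c r<n fr λ i i≢r → f≗g (suc i) (i≢r ∘ ℕ.suc-injective)))
        (shape (g 0) c (∏< n (g ∘ suc)))
  where
  shape : ∀ x c y → x * (c * y) ≡ c * (x * y)
  shape = solve-∀

_when_ : ℤ → Dec P → ℤ
x when yes _ = x
x when no  _ = 1ℤ

when-cong : (p? : Dec P) (q? : Dec Q) {x y : ℤ} → (P → Q) → (Q → P) → (P → x ≡ y) → x when p? ≡ y when q?
when-cong (yes p) (yes q) f g e = e p
when-cong (yes p) (no ¬q) f g e = contradiction (f p) ¬q
when-cong (no ¬p) (yes q) f g e = contradiction (g q) ¬p
when-cong (no ¬p) (no ¬q) f g e = refl

when-yes : (p? : Dec P) {x : ℤ} → P → x when p? ≡ x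
when-yes (yes _) p = refl
when-yes (no ¬p) p = contradiction p ¬p

when-no : (p? : Dec P) {x : ℤ} → ¬ P → x when p? ≡ 1ℤ
when-no (yes p) ¬p = contradiction p ¬p
when-no (no _)  ¬p = refl

∏ₗ-filter-upTo : ∀ {P : ℕ → Set} (P? : ∀ x → Dec (P x)) n f →
                 ∏ₗ (filter P? (upTo n)) f ≡ ∏< n (λ x → f x when P? x)
∏ₗ-filter-upTo P? n f = go n id
  where
  go : ∀ n g → ∏ₗ (filter P? (applyUpTo g n)) f ≡ ∏< n (λ x → f (g x) when P? (g x))
  go zero    g = refl
  go (suc n) g with P? (g 0)
  ... | yes _ = cong (f (g 0) *_) (go n (g ∘ suc))
  ... | no  _ = trans (go n (g ∘ suc)) (sym (ℤ.*-identityˡ _))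

Odd : ℕ → Set
Odd p = ∃[ h ] p ≡ suc (h ℕ.+ h)

odd-divisor : ∀ {q n} → n % 2 ≡ 1 → q ℕ.∣ n → Odd q
odd-divisor {q} {n} n-odd q∣n with q % 2 | m≡m%n+[m/n]*n q 2 | m%n<n q 2
... | 0 | q≡ | _ = contradiction
  (trans (sym (ℕ.n∣m⇒m%n≡0 n 2 (ℕ.∣-trans (ℕ.divides (q / 2) q≡) q∣n))) n-odd) λ ()
... | 1 | q≡ | _ = q / 2 , trans q≡ (cong suc (trans (ℕ.*-comm (q / 2) 2)
                     (cong (λ m → q / 2 ℕ.+ m) (ℕ.+-identityʳ (q / 2)))))
... | suc (suc _) | _ | s≤s (s≤s ())

primeDivisor? : ∀ n q → Dec (Prime q × q ℕ.∣ n)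
primeDivisor? n q = prime? q ×-dec (q ℕ.∣? n)

-- From prime moduli to odd moduli

module Assembly (k : ℕ) (c : ℤ) where

  F : ℕ → ℤ
  F n = W n (suc k) c

  -- The share of q^v for v ≥ 1: the prime count, followed by v - 1 lifts worth q^k each, there
  -- being `suc k` coordinates.
  local : ℕ → ℕ → ℤ
  local q v = + (q ℕ.^ (k ℕ.* (v ∸ 1))) * F q

  factor : ℕ → ℕ → ℤ
  factor n q = local q (ν q n) when primeDivisor? n q

  W-one : ∀ k a → W 1 k a ≡ 1ℤ
  W-one zero    a = ⟦⟧-yes (+ 1 ∣? a) (∣ᵤ⇒∣ (ℕ.1∣ ∣ a ∣))
  W-one (suc k) a = trans (ℤ.+-identityʳ _) (cong₂ _*_
    (⟦⟧-yes (exceptional? 1 0ℤ) ((ℕ.∣1⇒≡1 ∘ proj₁) , (ℕ.∣1⇒≡1 ∘ proj₁)))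
    (W-one k (a - 0ℤ * 0ℤ)))

  -- Induction on the prime factors with multiplicity: a prime already dividing the rest is a lift,
  -- a new one splits off by coprimality. The bound N is free so that the induction hypothesis has
  -- the same range.
  F-product : ∀ ps → All.All Prime ps → All.All Odd ps → ∀ N → product ps < N →
              F (product ps) ≡ ∏< N (factor (product ps))
  F-product [] _ _ N _ = trans (W-one (suc k) c) (sym (∏-one N (factor 1) λ q →
    when-no (primeDivisor? 1 q) λ { (q-prime , q∣1) →
      ¬prime[1] (subst Prime (ℕ.∣1⇒≡1 q∣1) q-prime) }))
  F-product (p ∷ ps) (p-prime All.∷ ps-prime) ((h , p≡1+2h) All.∷ ps-odd) N pn<N = by-cases (p ℕ.∣? n)
    where
    open PrimeModulus p p-prime h p≡1+2h using (W-lift)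
    n = product ps
    instance
      p-nonZero : NonZero p
      p-nonZero = prime⇒nonZero p-prime
      n-nonZero : NonZero n
      n-nonZero = productOfPrimes≢0 ps-prime
    v : Valuation p n
    v = valuation-product p-prime ps-prime
    a = Valuation.exponent v
    ν[n] : ν p n ≡ a
    ν[n] = ν≡exponent p-prime v
    ν[pn] : ν p (p ℕ.* n) ≡ suc a
    ν[pn] = ν≡exponent p-prime (valuation-same v)
    n<N : n < N
    n<N = ℕ.≤-<-trans (ℕ.m≤n*m n p) pn<N
    p<N : p < N
    p<N = ℕ.≤-<-trans (ℕ.m≤m*n p n) pn<N
    IH : F n ≡ ∏< N (factor n)
    IH = F-product ps ps-prime ps-odd N n<N
    others : ∀ q → q ≢ p → factor (p ℕ.* n) q ≡ factor n q
    others q q≢p = when-cong (primeDivisor? (p ℕ.* n) q) (primeDivisor? n q)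
      (λ { (q-prime , q∣pn) → q-prime , Data.Sum.[ (λ q∣p → contradiction (prime∣prime⇒≡ q-prime p-prime q∣p) q≢p) , id ]
             (euclidsLemma p n q-prime q∣pn) })
      (λ { (q-prime , q∣n) → q-prime , ℕ.∣n⇒∣m*n p q∣n })
      (λ { (q-prime , _) → cong (local q) (trans
             (ν≡exponent q-prime (valuation-other q-prime p-prime q≢p (valuation-product q-prime ps-prime)))
             (sym (ν≡exponent q-prime (valuation-product q-prime ps-prime)))) })
    factor[pn] : factor (p ℕ.* n) p ≡ local p (suc a)
    factor[pn] = trans (when-yes (primeDivisor? (p ℕ.* n) p) (p-prime , ℕ.m∣m*n n)) (cong (local p) ν[pn])
    by-cases : Dec (p ℕ.∣ n) → F (p ℕ.* n) ≡ ∏< N (factor (p ℕ.* n))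
    by-cases (yes p∣n) = begin
      F (p ℕ.* n)                           ≡⟨ W-lift n k c p∣n ⟩
      + (p ℕ.^ k) * F n                     ≡⟨ cong (+ (p ℕ.^ k) *_) IH ⟩
      + (p ℕ.^ k) * ∏< N (factor n)         ≡⟨ ∏-scale N p (+ (p ℕ.^ k)) p<N at-p others ⟨
      ∏< N (factor (p ℕ.* n))               ∎
      where
      b = proj₁ (exponent>0 p∣n v)
      a≡1+b : a ≡ suc b
      a≡1+b = proj₂ (exponent>0 p∣n v)
      at-p : factor (p ℕ.* n) p ≡ + (p ℕ.^ k) * factor n p
      at-p = begin
        factor (p ℕ.* n) p
          ≡⟨ trans factor[pn] (cong (λ a → local p (suc a)) a≡1+b) ⟩
        + (p ℕ.^ (k ℕ.* suc b)) * F p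
          ≡⟨ cong (λ m → + m * F p) (trans (cong (p ℕ.^_) (ℕ.*-suc k b)) (ℕ.^-distribˡ-+-* p k (k ℕ.* b))) ⟩
        + (p ℕ.^ k ℕ.* p ℕ.^ (k ℕ.* b)) * F p
          ≡⟨ cong (_* F p) (ℤ.pos-* (p ℕ.^ k) (p ℕ.^ (k ℕ.* b))) ⟩
        (+ (p ℕ.^ k) * + (p ℕ.^ (k ℕ.* b))) * F p
          ≡⟨ ℤ.*-assoc (+ (p ℕ.^ k)) (+ (p ℕ.^ (k ℕ.* b))) (F p) ⟩
        + (p ℕ.^ k) * local p (suc b)
          ≡⟨ cong (+ (p ℕ.^ k) *_) (trans (when-yes (primeDivisor? n p) (p-prime , p∣n))
               (cong (local p) (trans ν[n] a≡1+b))) ⟨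
        + (p ℕ.^ k) * factor n p  ∎
    by-cases (no p∤n) = begin
      F (p ℕ.* n)               ≡⟨ W-CRT p n (suc k) c coprime ⟩
      F p * F n                 ≡⟨ cong (F p *_) IH ⟩
      F p * ∏< N (factor n)     ≡⟨ ∏-scale N p (F p) p<N at-p others ⟨
      ∏< N (factor (p ℕ.* n))   ∎
      where
      coprime : Coprime p n
      coprime (d∣p , d∣n) with prime⇒irreducible p-prime d∣p
      ... | inj₁ d≡1  = d≡1
      ... | inj₂ refl = contradiction d∣n p∤n
      at-p : factor (p ℕ.* n) p ≡ F p * factor n p
      at-p = begin
        factor (p ℕ.* n) p     ≡⟨ trans factor[pn] (cong (λ a → local p (suc a)) (exponent≡0 p∤n v)) ⟩
        + (p ℕ.^ (k ℕ.* 0)) * F p  ≡⟨ cong (λ m → + (p ℕ.^ m) * F p) (ℕ.*-zeroʳ k) ⟩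
        1ℤ * F p               ≡⟨ ℤ.*-comm 1ℤ (F p) ⟩
        F p * 1ℤ               ≡⟨ cong (F p *_) (when-no (primeDivisor? n p) (p∤n ∘ proj₂)) ⟨
        F p * factor n p       ∎

-- The formula in rational numbers

-- `_/_` and the product in ℚ both normalise by a gcd; identities become integer identities on
-- unnormalised fractions.
fromℚᵘ-homo-* : ∀ a b → ℚ.fromℚᵘ a ℚ.* ℚ.fromℚᵘ b ≡ ℚ.fromℚᵘ (a ℚᵘ.* b)
fromℚᵘ-homo-* a b = ℚ.toℚᵘ-injective (ℚᵘ.≃-trans (ℚ.toℚᵘ-homo-* (ℚ.fromℚᵘ a) (ℚ.fromℚᵘ b))
  (ℚᵘ.≃-trans (ℚᵘ.*-cong (ℚ.toℚᵘ-fromℚᵘ a) (ℚ.toℚᵘ-fromℚᵘ b)) (ℚᵘ.≃-sym (ℚ.toℚᵘ-fromℚᵘ (a ℚᵘ.* b)))))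

toℚ-* : ∀ x y → toℚ (x * y) ≡ toℚ x ℚ.* toℚ y
toℚ-* x y = sym (fromℚᵘ-homo-* (ℚᵘ.mkℚᵘ x 0) (ℚᵘ.mkℚᵘ y 0))

inv-* : ∀ q .{{_ : NonZero q}} x → inv q ℚ.* toℚ (+ q * x) ≡ toℚ x
inv-* (suc r) x = trans (fromℚᵘ-homo-* (ℚᵘ.mkℚᵘ (+ 1) r) (ℚᵘ.mkℚᵘ (+ suc r * x) 0))
  (ℚ.fromℚᵘ-cong {ℚᵘ.mkℚᵘ (+ 1) r ℚᵘ.* ℚᵘ.mkℚᵘ (+ suc r * x) 0} {ℚᵘ.mkℚᵘ x 0} (ℚᵘ.*≡* (trans (shape (+ suc r) x) (cong (x *_) (cong (λ m → + m) (sym (ℕ.*-identityʳ (suc r))))))))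
  where
  shape : ∀ q x → 1ℤ * (q * x) * 1ℤ ≡ x * q
  shape = solve-∀

-- The case m = 0 arises when p divides n exactly once: there the power is a true p⁻¹.
powℤ-pred : ∀ p .{{_ : NonZero p}} m x → powℤ p (+ m - 1ℤ) ℚ.* toℚ (+ p * x) ≡ toℚ (+ (p ℕ.^ m) * x)
powℤ-pred p zero    x = begin
  inv (p ℕ.* 1) ℚ.* toℚ (+ p * x)   ≡⟨ cong (λ q → inv q ℚ.* toℚ (+ p * x)) (ℕ.*-identityʳ p) ⟩
  inv p ℚ.* toℚ (+ p * x)           ≡⟨ inv-* p x ⟩
  toℚ x                             ≡⟨ cong toℚ (ℤ.*-identityˡ x) ⟨
  toℚ (1ℤ * x)                      ∎
powℤ-pred p (suc m) x = trans (sym (toℚ-* (+ (p ℕ.^ m)) (+ p * x)))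
  (cong toℚ (trans (shape (+ (p ℕ.^ m)) (+ p) x) (cong (_* x) (sym (ℤ.pos-* p (p ℕ.^ m))))))
  where
  shape : ∀ q p x → q * (p * x) ≡ (p * q) * x
  shape = solve-∀

exponent-shape : ∀ k v → + (suc k ℕ.* suc v) - + suc v - + suc k ≡ + (k ℕ.* v) - 1ℤ
exponent-shape k v = begin
  + (suc k ℕ.* suc v) - + suc v - + suc k       ≡⟨ cong (λ s → s - + suc v - + suc k) (ℤ.pos-* (suc k) (suc v)) ⟩
  + suc k * + suc v - + suc v - + suc k         ≡⟨ shape (+ k) (+ v) ⟩
  + k * + v - 1ℤ                                ≡⟨ cong (_- 1ℤ) (ℤ.pos-* k v) ⟨
  + (k ℕ.* v) - 1ℤ                              ∎
  where
  shape : ∀ k v → (1ℤ + k) * (1ℤ + v) - (1ℤ + v) - (1ℤ + k) ≡ k * v - 1ℤ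
  shape = solve-∀

sgn*sgn : ∀ k → sgn k * sgn k ≡ 1ℤ
sgn*sgn k = trans (sym (ℤ.^-distribˡ-+-* -1ℤ k k))
  (trans (cong (λ m → sgn (k ℕ.+ m)) (sym (ℕ.+-identityʳ k))) (sgn-2* k))

module _ (k : ℕ) (c : ℤ) (n : ℕ) where

  open Assembly k c

  euler : ℕ → ℚ
  euler p = powℤ p (+ (suc k ℕ.* ν p n) - + ν p n - + suc k) ℚ.* toℚ (bracket (suc k) c p)

  -- The global sign is shared out as one (- 1)^k per prime, where it meets the equal sign in
  -- `W-prime` and squares to 1.
  euler-local : ∀ p → Prime p → Odd p → Valuation p n → p ℕ.∣ n →
                toℚ (sgn (suc k)) ℚ.* euler p ≡ toℚ (local p (ν p n))
  euler-local p p-prime (h , p≡1+2h) val p∣n = begin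
    toℚ s ℚ.* euler p
      ≡⟨ cong (λ v → toℚ s ℚ.* (powℤ p (+ (suc k ℕ.* v) - + v - + suc k) ℚ.* toℚ (bracket (suc k) c p))) ν≡1+b ⟩
    toℚ s ℚ.* (powℤ p (+ (suc k ℕ.* suc b) - + suc b - + suc k) ℚ.* toℚ (bracket (suc k) c p))
      ≡⟨ cong₂ (λ E B → toℚ s ℚ.* (powℤ p E ℚ.* toℚ B)) (exponent-shape k b)
           (sym (W-prime (suc k) c (s≤s z≤n))) ⟩
    toℚ s ℚ.* (pᴱ ℚ.* toℚ (s * (+ p * F p)))
      ≡⟨ trans (sym (ℚ.*-assoc (toℚ s) pᴱ (toℚ (s * (+ p * F p)))))
           (trans (cong (ℚ._* toℚ (s * (+ p * F p))) (ℚ.*-comm (toℚ s) pᴱ))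
                  (ℚ.*-assoc pᴱ (toℚ s) (toℚ (s * (+ p * F p))))) ⟩
    pᴱ ℚ.* (toℚ s ℚ.* toℚ (s * (+ p * F p)))
      ≡⟨ cong (pᴱ ℚ.*_) (toℚ-* s (s * (+ p * F p))) ⟨
    pᴱ ℚ.* toℚ (s * (s * (+ p * F p)))
      ≡⟨ cong (λ x → pᴱ ℚ.* toℚ x) (trans (sym (ℤ.*-assoc s s (+ p * F p)))
           (trans (cong (_* (+ p * F p)) (sgn*sgn (suc k))) (ℤ.*-identityˡ (+ p * F p)))) ⟩
    pᴱ ℚ.* toℚ (+ p * F p)
      ≡⟨ powℤ-pred p (k ℕ.* b) (F p) ⟩
    toℚ (local p (suc b))
      ≡⟨ cong (toℚ ∘ local p) ν≡1+b ⟨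
    toℚ (local p (ν p n))  ∎
    where
    open PrimeModulus p p-prime h p≡1+2h using (W-prime)
    instance
      p-nonZero : NonZero p
      p-nonZero = prime⇒nonZero p-prime
    s = sgn (suc k)
    b = proj₁ (exponent>0 p∣n val)
    ν≡1+b : ν p n ≡ suc b
    ν≡1+b = trans (ν≡exponent p-prime val) (proj₂ (exponent>0 p∣n val))
    pᴱ = powℤ p (+ (k ℕ.* b) - 1ℤ)

  euler-product : ∀ ps → All.All (λ p → toℚ (sgn (suc k)) ℚ.* euler p ≡ toℚ (local p (ν p n))) ps →
                  toℚ (sgn (suc k ℕ.* length ps)) ℚ.* prodℚ ps euler ≡ toℚ (∏ₗ ps (λ p → local p (ν p n)))
  euler-product []       All.[]       = cong (λ m → toℚ (sgn m) ℚ.* ℚ.1ℚ) (ℕ.*-zeroʳ (suc k))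
  euler-product (p ∷ ps) (e All.∷ es) = begin
    toℚ (sgn (suc k ℕ.* suc (length ps))) ℚ.* (euler p ℚ.* prodℚ ps euler)
      ≡⟨ cong (ℚ._* (euler p ℚ.* prodℚ ps euler)) (trans
           (cong toℚ (trans (cong sgn (ℕ.*-suc (suc k) (length ps)))
             (ℤ.^-distribˡ-+-* -1ℤ (suc k) (suc k ℕ.* length ps))))
           (toℚ-* (sgn (suc k)) (sgn (suc k ℕ.* length ps)))) ⟩
    (s ℚ.* t) ℚ.* (euler p ℚ.* prodℚ ps euler)
      ≡⟨ ℚ-interchange s t (euler p) (prodℚ ps euler) ⟩
    (s ℚ.* euler p) ℚ.* (t ℚ.* prodℚ ps euler)
      ≡⟨ cong₂ ℚ._*_ e (euler-product ps es) ⟩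
    toℚ (local p (ν p n)) ℚ.* toℚ (∏ₗ ps (λ p → local p (ν p n)))
      ≡⟨ toℚ-* (local p (ν p n)) (∏ₗ ps (λ p → local p (ν p n))) ⟨
    toℚ (∏ₗ (p ∷ ps) (λ p → local p (ν p n)))  ∎
    where
    s = toℚ (sgn (suc k))
    t = toℚ (sgn (suc k ℕ.* length ps))

N2-odd : ∀ n k c → 1 ≤ n → n % 2 ≡ 1 → toℚ (+ N2 (suc k) c n) ≡ rhs (suc k) c n
N2-odd n@(suc _) k c _ n-odd = begin
  toℚ (+ N2 (suc k) c n)
    ≡⟨ cong toℚ (N2≡W n (suc k) c) ⟩
  toℚ (F n)
    ≡⟨ cong (toℚ ∘ F) n≡∏ ⟩
  toℚ (F (product ps))
    -- The bound `suc n` is the range over which `primeDivisors n` filters.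
    ≡⟨ cong toℚ (F-product ps ps-prime ps-odd (suc n) (subst (_< suc n) n≡∏ (ℕ.n<1+n n))) ⟩
  toℚ (∏< (suc n) (factor (product ps)))
    ≡⟨ cong (λ m → toℚ (∏< (suc n) (factor m))) n≡∏ ⟨
  toℚ (∏< (suc n) (factor n))
    ≡⟨ cong toℚ (∏ₗ-filter-upTo (primeDivisor? n) (suc n) (λ q → local q (ν q n))) ⟨
  toℚ (∏ₗ (primeDivisors n) (λ q → local q (ν q n)))
    ≡⟨ euler-product k c n (primeDivisors n) (All.map
         (λ { {q} (q-prime , q∣n) → euler-local k c n q q-prime (odd-divisor n-odd q∣n)
                (subst (Valuation q) (sym n≡∏) (valuation-product q-prime ps-prime)) q∣n })
         (all-filter (primeDivisor? n) (upTo (suc n)))) ⟨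
  rhs (suc k) c n  ∎
  where
  open Assembly k c
  open PrimeFactorisation (factorise n) renaming (factors to ps; isFactorisation to n≡∏; factorsPrime to ps-prime)
  ps-odd : All.All Odd ps
  ps-odd = All.tabulate λ {q} q∈ps → odd-divisor n-odd (subst (q ℕ.∣_) (sym n≡∏) (∈⇒∣product q∈ps))

theorem1p1 : (n k : ℕ) (c : ℤ) → 1 ≤ n → 2 ≤ k →
    (n % 2 ≡ 0 → N2 k c n ≡ 0) ×
    (n % 2 ≡ 1 → toℚ (+ N2 k c n) ≡ rhs k c n)
theorem1p1 n (suc k) c 1≤n _ =
  (λ n-even → ℤ.+-injective (trans (N2≡W n (suc k) c) (W-even n k c (ℕ.m%n≡0⇒n∣m n 2 n-even)))) ,
  N2-odd n k c 1≤n
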